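{- Let $n\in\mathbb{N}$, let $\lambda$ be a partition of $n$ and let $U\in\mathrm{SYT}(\lambda)$. For all cells $x\in\lambda$ and all entries $1\le b\le n$, the drop function can be derived from the signed exit numbers as $$d_U(b,x)=(n-1)!+\sum_{a=1}^{b-1}\Delta_U(a,x).$$ Furthermore, if $U,V\in\mathrm{SYT}(\lambda)$ define equidistributed Novelli--Pak--Stoyanovskii algorithms, that is, $Z_U=Z_V$, then for all $x\in\lambda$ and $1\le b\le n$ we have $d_U(b,x)=d_V(b,x)$.
   Context: A partition $\lambda=(\lambda_1\ge\lambda_2\ge\dots)$ of $n$ is identified with its Young diagram $\{(i,j): i\ge 1,\ 1\le j\le\lambda_i\}$ (English convention: row $i$, column $j$). A tableau of shape $\lambda$ is a bijection $T:\lambda\to\{1,\dots,n\}$; $\mathrm{T}(\lambda)$ is the set of all tableaux. $\mathrm{SYT}(\lambda)\subseteq \mathrm{T}(\lambda)$ is the set of standard Young tableaux, i.e. tableaux increasing along rows from left to right and along columns from top to bottom. For a cell $x=(i,j)\in\lambda$ put $N^-(x)=N_\lambda^-(x)=\{(i-1,j),(i,j-1)\}\cap\lambda$ and $N^+(x)=N_\lambda^+(x)=\{(i+1,j),(i,j+1)\}\cap\lambda$, and define its height $h'_\lambda(x)=(i-1)+(j-1)$. For an entry $b$ and a tableau $T$ put $h'(b,T)=h'_\lambda(T^{ -1}(b))$. Novelli--Pak--Stoyanovskii algorithm corresponding to $U\in\mathrm{SYT}(\lambda)$: order the cells by $x\prec_U y :\Leftrightarrow U(x)<U(y)$. Given $T\in\mathrm{T}(\lambda)$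 set $T_0=T$. If $T_s$ is not a standard Young tableau, let $x$ be the $\prec_U$-maximal cell with $N_\lambda^+(x)\neq\emptyset$ and $T_s(x)>\min\{T_s(y):y\in N_\lambda^+(x)\}$, and let $T_{s+1}$ be obtained from $T_s$ by exchanging the entry $T_s(x)$ with the entry $\min\{T_s(y):y\in N_\lambda^+(x)\}$. The process stops at the first tableau $T_r$ which is standard; write $r_U(T)=r$ and $\varphi_U(T)=T_r$. Distribution vector: for $W\in\mathrm{SYT}(\lambda)$ let $z_U(W)=|\{T\in\mathrm{T}(\lambda):\varphi_U(T)=W\}|$, and $Z_U=(z_U(W))_{W\in\mathrm{SYT}(\lambda)}$. Local exchange numbers: for $1\le a<b\le n$ and $x,y\in\lambda$ let $m_U(a,b,x,y)$ be the number of $T\in\mathrm{T}(\lambda)$ such that for some $1\le i\le r_U(T)$ we have $T_{i-1}(x)=a$, $T_{i-1}(y)=b$, $T_i(x)=b$, $T_i(y)=a$. It is known that this does not depend on the choice of $b>a$, and one writes $m_U(a,x,y)=m_U(a,b,x,y)$ for any $b$ with $a<b\le n$. The signed exit number of the entry $a$ (with $1\le a<n$) at the cell $x$ is $$\Delta_U(a,x)=\sum_{y\in N^-(x)}m_U(a,x,y)-\sum_{y\in N^+(x)}m_U(a,y,x).$$ Drop function: for an entry $b$ and $T\in\mathrm{T}(\lambda)$, let $\beta_U(b,T)=\max_{0\le i\le r_U(T)}h'(b,T_i)$ be the maximal height attained by $b$ during the sorting of $T$ (there is a unique cell of this height which contains $b$ at some point). Let $d_U(b,x,T)=1$ if $h'_\lambda(x)=\beta_U(b,T)$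 and $T_i(x)=b$ for some $0\le i\le r_U(T)$, and $d_U(b,x,T)=0$ otherwise. Then $d_U(b,x)=\sum_{T\in\mathrm{T}(\lambda)}d_U(b,x,T)$. -}

module Defs where

open import Data.Fin as Fin using (Fin; zero; suc; toℕ)
open import Data.Fin.Permutation using (Permutation′; id; insert; transpose)
import Data.Fin.Properties as Fin
open import Data.Integer as ℤ using (ℤ; 0ℤ)
open import Data.List
  using (List; []; _∷_; map; concatMap; filter; length; lookup; foldr; allFin; upTo)
import Data.List.Extrema as Extrema
open import Data.List.Extrema.Nat using (argmax; argmax-sel; max)
open import Data.List.Membership.Propositional using (_∈_)
open import Data.List.Membership.Propositional.Properties
  using (∈-filter⁺; ∈-filter⁻; ∈-map⁺; ∈-map⁻; ∈-allFin)
open import Data.List.Relation.Unary.All as All using (All)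
open import Data.List.Relation.Unary.Any using (here; there)
open import Data.List.Relation.Unary.Linked as Linked using (Linked)
open import Data.Nat as ℕ using (ℕ; zero; suc; _+_; _*_; _≤_; _<_; _≥_; z≤n; s≤s)
open import Data.Nat.ListAction using (sum)
import Data.Nat.Properties as ℕ
open import Data.Nat.Solver using (module +-*-Solver)
open import Data.Product using (Σ; Σ-syntax; ∃-syntax; _×_; _,_; proj₁; proj₂)
open import Data.Sum using (_⊎_; inj₁; inj₂)
import Data.Sum.Function.Propositional as Sum
open import Function using (_∘_; Inverse; _↔_; mk↔ₛ′)
open import Function.Properties.Inverse using (↔-refl; ↔-sym; ↔-trans)
open import Relation.Binary.Definitions using (tri<; tri≈; tri>)
open import Relation.Binary.PropositionalEquality
  using (_≡_; _≢_; refl; sym; trans; cong; cong₂; subst; subst₂)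
open import Relation.Nullary using (Dec; yes; no; ¬_; contradiction)
open import Relation.Nullary.Decidable using (map′; _×-dec_; _⊎-dec_; _→-dec_)
open import Relation.Unary using (Decidable)

record Partition (n : ℕ) : Set where
  field
    parts      : List ℕ
    decreasing : Linked _≥_ parts
    positive   : All (0 <_) parts
    size       : sum parts ≡ n

open Partition public

-- Rows and columns are numbered from 0.
record Cell {n : ℕ} (Λ : Partition n) : Set where
  constructor _,_
  field
    rowᶠ : Fin (length (parts Λ))
    colᶠ : Fin (lookup (parts Λ) rowᶠ)

open Cell public

-- The entries 1, …, n are represented, in order, by the elements
-- 0, …, n - 1 of Fin n.
Tableau : {n : ℕ} → Partition n → Set
Tableau {n} Λ = Cell Λ ↔ Fin n

module _ {n : ℕ} {Λ : Partition n} where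

  row col height : Cell Λ → ℕ
  row x = toℕ (rowᶠ x)
  col x = toℕ (colᶠ x)
  height x = row x + col x

  infix 8 _at_
  _at_ : Tableau Λ → Cell Λ → Fin n
  T at x = Inverse.to T x

  cellOf : Tableau Λ → Fin n → Cell Λ
  cellOf T b = Inverse.from T b

  infix 4 _≈_
  _≈_ : Tableau Λ → Tableau Λ → Set
  T ≈ T′ = ∀ x → T at x ≡ T′ at x

  Standard : Tableau Λ → Set
  Standard T =
    (∀ x y → row x ≡ row y → col x < col y → T at x Fin.< T at y) ×
    (∀ x y → col x ≡ col y → row x < row y → T at x Fin.< T at y)

record SYT {n : ℕ} (Λ : Partition n) : Set where
  field
    tableau  : Tableau Λ
    standard : Standard tableau

open SYT public

cells↔ : (ps : List ℕ) → (Σ (Fin (length ps)) λ i → Fin (lookup ps i)) ↔ Fin (sum ps)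
cells↔ []       = mk↔ₛ′ (λ ()) (λ ()) (λ ()) (λ ())
cells↔ (p ∷ ps) =
  ↔-trans split (↔-trans (↔-refl Sum.⊎-↔ cells↔ ps) (↔-sym Fin.+↔⊎))
  where
  split : (Σ (Fin (suc (length ps))) λ i → Fin (lookup (p ∷ ps) i)) ↔
          (Fin p ⊎ Σ (Fin (length ps)) λ i → Fin (lookup ps i))
  split = mk↔ₛ′
    (λ { (zero , j) → inj₁ j ; (suc i , j) → inj₂ (i , j) })
    (λ { (inj₁ j) → zero , j ; (inj₂ (i , j)) → suc i , j })
    (λ { (inj₁ _) → refl ; (inj₂ _) → refl })
    (λ { (zero , _) → refl ; (suc _ , _) → refl })

-- The tableau filled row by row with 1, …, n.
reading : {n : ℕ} (Λ : Partition n) → Tableau Λ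
reading {n} Λ =
  ↔-trans
    (mk↔ₛ′ (λ x → rowᶠ x , colᶠ x) (λ (i , j) → i , j) (λ _ → refl) (λ _ → refl))
    (subst (λ k → (Σ (Fin (length (parts Λ))) λ i → Fin (lookup (parts Λ) i)) ↔ Fin k)
           (size Λ) (cells↔ (parts Λ)))

cells : {n : ℕ} (Λ : Partition n) → List (Cell Λ)
cells {n} Λ = map (cellOf (reading Λ)) (allFin n)

-- Every permutation occurs exactly once up to pointwise equality:
-- insert zero j π sends 0 to j and acts on the other elements as π.
permutations : (n : ℕ) → List (Permutation′ n)
permutations zero    = id ∷ []
permutations (suc n) =
  concatMap (λ j → map (insert zero j) (permutations n)) (allFin (suc n))

-- Every tableau of shape Λ, exactly once up to _≈_.
tableaux : {n : ℕ} (Λ : Partition n) → List (Tableau Λ)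
tableaux {n} Λ = map (↔-trans (reading Λ)) (permutations n)

count : {n : ℕ} {Λ : Partition n} {P : Tableau Λ → Set} → Decidable P → ℕ
count {Λ = Λ} P? = length (filter P? (tableaux Λ))

Σᶠ : {k : ℕ} → (Fin k → ℕ) → ℕ
Σᶠ {zero}  f = 0
Σᶠ {suc k} f = f zero + Σᶠ (f ∘ suc)

Σᶠ-cong : {k : ℕ} {f g : Fin k → ℕ} → (∀ i → f i ≡ g i) → Σᶠ f ≡ Σᶠ g
Σᶠ-cong {zero}  eq = refl
Σᶠ-cong {suc k} eq = cong₂ _+_ (eq zero) (Σᶠ-cong (eq ∘ suc))

Σᶠ-bound : {k m : ℕ} (f : Fin k → ℕ) → (∀ i → f i ≤ m) → Σᶠ f ≤ k * m
Σᶠ-bound {zero}  f le = z≤n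
Σᶠ-bound {suc k} f le = ℕ.+-mono-≤ (le zero) (Σᶠ-bound (f ∘ suc) (le ∘ suc))

Σᶠ-update : {k : ℕ} (f g : Fin k → ℕ) (i : Fin k) → (∀ j → j ≢ i → f j ≡ g j) →
  Σᶠ f + g i ≡ Σᶠ g + f i
Σᶠ-update f g zero eq =
  trans (cong (λ t → f zero + t + g zero) (Σᶠ-cong λ j → eq (suc j) λ ()))
    (solve 3 (λ a b c → a :+ b :+ c := c :+ b :+ a) refl (f zero) (Σᶠ (g ∘ suc)) (g zero))
  where open +-*-Solver
Σᶠ-update f g (suc i) eq =
  trans (ℕ.+-assoc (f zero) (Σᶠ (f ∘ suc)) (g (suc i)))
    (trans (cong₂ _+_ (eq zero λ ())
             (Σᶠ-update (f ∘ suc) (g ∘ suc) i λ j j≢i → eq (suc j) (j≢i ∘ Fin.suc-injective)))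
      (sym (ℕ.+-assoc (g zero) (Σᶠ (g ∘ suc)) (f (suc i)))))

Σᶠ-swap : {m : ℕ} (f g : Fin m → ℕ) (k l : Fin m) → k Fin.< l →
  f l < f k → g k ≡ f l → g l ≡ f k → (∀ j → j ≢ k → j ≢ l → f j ≡ g j) →
  Σᶠ (λ i → toℕ i * f i) < Σᶠ (λ i → toℕ i * g i)
Σᶠ-swap {m} f g k l k<l fl<fk gk gl eq = ℕ.+-cancelʳ-< (A + B) F G lemma
  where
  open +-*-Solver
  h : Fin m → ℕ
  h i with i Fin.≟ l
  ... | yes _ = toℕ i * g i
  ... | no  _ = toℕ i * f i
  h-l : h l ≡ toℕ l * g l
  h-l with l Fin.≟ l
  ... | yes _ = refl
  ... | no ne = contradiction refl ne
  h-≢ : ∀ j → j ≢ l → h j ≡ toℕ j * f j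
  h-≢ j ne with j Fin.≟ l
  ... | yes e = contradiction e ne
  ... | no  _ = refl
  h-g : ∀ j → j ≢ k → h j ≡ toℕ j * g j
  h-g j ne with j Fin.≟ l
  ... | yes _  = refl
  ... | no ne′ = cong (toℕ j *_) (eq j ne ne′)
  F G H A B C D : ℕ
  F = Σᶠ (λ i → toℕ i * f i)
  G = Σᶠ (λ i → toℕ i * g i)
  H = Σᶠ h
  A = toℕ k * f k
  B = toℕ l * f l
  C = toℕ k * f l
  D = toℕ l * f k
  e₁ : F + D ≡ H + B
  e₁ = trans (cong (F +_) (trans (cong (toℕ l *_) (sym gl)) (sym h-l)))
         (Σᶠ-update (λ i → toℕ i * f i) h l λ j ne → sym (h-≢ j ne))
  e₂ : H + C ≡ G + A
  e₂ = trans (cong (H +_) (cong (toℕ k *_) (sym gk)))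
         (trans (Σᶠ-update h (λ i → toℕ i * g i) k h-g)
           (cong (G +_) (h-≢ k λ k≡l → ℕ.<-irrefl (cong toℕ k≡l) k<l)))
  e₃ : F + (C + D) ≡ G + (A + B)
  e₃ = trans (solve 3 (λ x c d → x :+ (c :+ d) := x :+ d :+ c) refl F C D)
         (trans (cong (_+ C) e₁)
           (trans (solve 3 (λ x b c → x :+ b :+ c := x :+ c :+ b) refl H B C)
             (trans (cong (_+ B) e₂) (ℕ.+-assoc G A B))))
  rearrange : ∀ p q a b → p < q → a < b → p * b + q * a < p * a + q * b
  rearrange p q a b p<q a<b with ℕ.m≤n⇒∃[o]m+o≡n p<q | ℕ.m≤n⇒∃[o]m+o≡n a<b
  ... | u , refl | v , refl = subst (p * suc (a + v) + suc (p + u) * a <_)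
    (solve 4 (λ p a u v →
        (p :* (con 1 :+ (a :+ v)) :+ (con 1 :+ (p :+ u)) :* a) :+
          (con 1 :+ (u :+ v :+ u :* v))
        := p :* a :+ (con 1 :+ (p :+ u)) :* (con 1 :+ (a :+ v)))
      refl p a u v)
    (ℕ.m<m+n _ (s≤s z≤n))
  lemma : F + (A + B) < G + (A + B)
  lemma = subst (F + (A + B) <_) e₃
    (ℕ.+-monoʳ-< F (rearrange (toℕ k) (toℕ l) (f l) (f k) k<l fl<fk))

transpose-l : {n : ℕ} (p q : Fin n) → Inverse.to (transpose p q) p ≡ q
transpose-l p q with p Fin.≟ p
... | yes _ = refl
... | no ne = contradiction refl ne

transpose-r : {n : ℕ} (p q : Fin n) → Inverse.to (transpose p q) q ≡ p
transpose-r p q with q Fin.≟ p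
... | yes e = e
... | no  _ with q Fin.≟ q
...   | yes _ = refl
...   | no ne = contradiction refl ne

module _ {n : ℕ} {Λ : Partition n} where

  ∀cell? : {P : Cell Λ → Set} → Decidable P → Dec (∀ x → P x)
  ∀cell? {P} P? =
    map′ (λ f x → subst P (Inverse.strictlyInverseʳ (reading Λ) x) (f (reading Λ at x)))
         (λ f k → f (cellOf (reading Λ) k))
         (Fin.all? (λ k → P? (cellOf (reading Λ) k)))

  _≈?_ : (T T′ : Tableau Λ) → Dec (T ≈ T′)
  T ≈? T′ = ∀cell? λ x → T at x Fin.≟ T′ at x

  standard? : Decidable (Standard {Λ = Λ})
  standard? T =
    ∀cell? (λ x → ∀cell? λ y →
      (row x ℕ.≟ row y) →-dec ((col x ℕ.<? col y) →-dec (T at x Fin.<? T at y)))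
    ×-dec
    ∀cell? (λ x → ∀cell? λ y →
      (col x ℕ.≟ col y) →-dec ((row x ℕ.<? row y) →-dec (T at x Fin.<? T at y)))

  -- y is the cell directly below x or directly to the right of x.
  infix 4 _⊲_ _⊲?_
  _⊲_ : Cell Λ → Cell Λ → Set
  x ⊲ y = (row y ≡ suc (row x) × col y ≡ col x) ⊎ (row y ≡ row x × col y ≡ suc (col x))

  _⊲?_ : (x y : Cell Λ) → Dec (x ⊲ y)
  x ⊲? y = ((row y ℕ.≟ suc (row x)) ×-dec (col y ℕ.≟ col x)) ⊎-dec
           ((row y ℕ.≟ row x) ×-dec (col y ℕ.≟ suc (col x)))

  N⁺ N⁻ : Cell Λ → List (Cell Λ)
  N⁺ x = filter (x ⊲?_) (cells Λ)
  N⁻ x = filter (_⊲? x) (cells Λ)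

  -- The minimum of T x and the entries of N⁺ x.  It is less than T x iff
  -- N⁺ x is nonempty and T x > min { T y : y ∈ N⁺ x }, and in that case
  -- it equals min { T y : y ∈ N⁺ x }.
  least : Tableau Λ → Cell Λ → Fin n
  least T x = Extrema.min (Fin.≤-totalOrder n) (T at x) (map (T at_) (N⁺ x))

  Unsorted : Tableau Λ → Cell Λ → Set
  Unsorted T x = least T x Fin.< T at x

  unsorted? : (T : Tableau Λ) → Decidable (Unsorted T)
  unsorted? T x = least T x Fin.<? T at x

  exchange : Tableau Λ → Cell Λ → Tableau Λ
  exchange T x = ↔-trans T (transpose (T at x) (least T x))

  -- A standard tableau has no unsorted cell and is left unchanged.
  step : SYT Λ → Tableau Λ → Tableau Λ
  step U T with filter (unsorted? T) (cells Λ)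
  ... | []     = T
  ... | x ∷ xs = exchange T (argmax (λ z → toℕ (tableau U at z)) x xs)

  -- seq U T s is the tableau T_s.
  seq : SYT Λ → Tableau Λ → ℕ → Tableau Λ
  seq U T zero    = T
  seq U T (suc s) = step U (seq U T s)

  ∈-cells : (x : Cell Λ) → x ∈ cells Λ
  ∈-cells x = subst (_∈ cells Λ) (Inverse.strictlyInverseʳ (reading Λ) x)
                (∈-map⁺ (cellOf (reading Λ)) (∈-allFin (reading Λ at x)))

  at-injective : (T : Tableau Λ) {x y : Cell Λ} → T at x ≡ T at y → x ≡ y
  at-injective T {x} {y} eq =
    trans (sym (Inverse.strictlyInverseʳ T x))
          (trans (cong (cellOf T) eq) (Inverse.strictlyInverseʳ T y))

  cell-≡ : {x y : Cell Λ} → row x ≡ row y → col x ≡ col y → x ≡ y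
  cell-≡ {i , j} {i′ , j′} r c with Fin.toℕ-injective r
  ... | refl = cong (i ,_) (Fin.toℕ-injective c)

  ⊲⇒< : (U : SYT Λ) {x y : Cell Λ} → x ⊲ y → tableau U at x Fin.< tableau U at y
  ⊲⇒< U {x} {y} (inj₁ (r , c)) =
    proj₂ (standard U) x y (sym c) (ℕ.≤-reflexive (sym r))
  ⊲⇒< U {x} {y} (inj₂ (r , c)) =
    proj₁ (standard U) x y (sym r) (ℕ.≤-reflexive (sym c))

  ⊲-irrefl : {x : Cell Λ} → ¬ x ⊲ x
  ⊲-irrefl (inj₁ (r , _)) = ℕ.1+n≢n (sym r)
  ⊲-irrefl (inj₂ (_ , c)) = ℕ.1+n≢n (sym c)

  left : (y : Cell Λ) {j : ℕ} → col y ≡ suc j → Σ[ x ∈ Cell Λ ] (row x ≡ row y × col x ≡ j)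
  left (i , j′) {j} eq = (i , Fin.fromℕ< j<) , refl , Fin.toℕ-fromℕ< j<
    where
    j< : j < lookup (parts Λ) i
    j< = ℕ.<-trans (ℕ.≤-reflexive (sym eq)) (Fin.toℕ<n j′)

  up : (y : Cell Λ) {i : ℕ} → row y ≡ suc i → Σ[ x ∈ Cell Λ ] (row x ≡ i × col x ≡ col y)
  up (i′ , j) eq with above (decreasing Λ) i′ eq
    where
    above : {ps : List ℕ} → Linked _≥_ ps → (i : Fin (length ps)) {k : ℕ} →
            toℕ i ≡ suc k → ∃[ i₁ ] (toℕ i₁ ≡ k × lookup ps i ≤ lookup ps i₁)
    above (p≥q Linked.∷ _) (suc zero)    refl = zero , refl , p≥q
    above (_ Linked.∷ l)   (suc (suc i)) refl with above l (suc i) refl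
    ... | i₁ , e , le = suc i₁ , cong suc e , le
  ... | i₁ , e , le = (i₁ , Fin.inject≤ j le) , e , Fin.toℕ-inject≤ j le

  ⊲-increasing⇒standard : (T : Tableau Λ) →
    (∀ {x y} → x ⊲ y → T at x Fin.< T at y) → Standard T
  ⊲-increasing⇒standard T inc =
    (λ x y → rows (col y) x y refl) , (λ x y → cols (row y) x y refl)
    where
    rows : ∀ k x y → col y ≡ k → row x ≡ row y → col x < col y → T at x Fin.< T at y
    rows zero x y c _ lt = contradiction (subst (col x <_) c lt) ℕ.n≮0
    rows (suc k) x y c r lt with left y c
    ... | z , rz , cz with ℕ.m≤n⇒m<n∨m≡n (ℕ.≤-pred (subst (col x <_) c lt))
    ...   | inj₁ x<k = ℕ.<-trans
                         (rows k x z cz (trans r (sym rz)) (subst (col x <_) (sym cz) x<k))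
                         (inc (inj₂ (sym rz , trans c (cong suc (sym cz)))))
    ...   | inj₂ x≡k = inc (inj₂ (sym r , trans c (cong suc (sym x≡k))))

    cols : ∀ k x y → row y ≡ k → col x ≡ col y → row x < row y → T at x Fin.< T at y
    cols zero x y r _ lt = contradiction (subst (row x <_) r lt) ℕ.n≮0
    cols (suc k) x y r c lt with up y r
    ... | z , rz , cz with ℕ.m≤n⇒m<n∨m≡n (ℕ.≤-pred (subst (row x <_) r lt))
    ...   | inj₁ x<k = ℕ.<-trans
                         (cols k x z rz (trans c (sym cz)) (subst (row x <_) (sym rz) x<k))
                         (inc (inj₁ (trans r (cong suc (sym rz)) , sym cz)))
    ...   | inj₂ x≡k = inc (inj₁ (trans r (cong suc (sym x≡k)) , sym c))

  sorted⇒standard : (T : Tableau Λ) → (∀ x → ¬ Unsorted T x) → Standard T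
  sorted⇒standard T sorted = ⊲-increasing⇒standard T inc
    where
    inc : ∀ {x y} → x ⊲ y → T at x Fin.< T at y
    inc {x} {y} x⊲y with Fin.<-cmp (T at x) (T at y)
    ... | tri< lt _ _ = lt
    ... | tri≈ _ eq _ =
      contradiction (subst (x ⊲_) (sym (at-injective T eq)) x⊲y) ⊲-irrefl
    ... | tri> _ _ gt = contradiction (ℕ.≤-<-trans min≤ gt) (sorted x)
      where
      min≤ : least T x Fin.≤ T at y
      min≤ = All.lookup (Extrema.min≤xs (Fin.≤-totalOrder n) (T at x) (map (T at_) (N⁺ x)))
               (∈-map⁺ (T at_) (∈-filter⁺ (x ⊲?_) (∈-cells y) x⊲y))

  unsorted⇒least : (T : Tableau Λ) (x : Cell Λ) → Unsorted T x →
    Σ[ y ∈ Cell Λ ] (x ⊲ y × T at y ≡ least T x)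
  unsorted⇒least T x uns
    with Extrema.argmin-sel (Fin.≤-totalOrder n) Function.id (T at x) (map (T at_) (N⁺ x))
  ... | inj₁ eq  = contradiction uns (ℕ.<-irrefl (cong toℕ eq))
  ... | inj₂ mem with ∈-map⁻ (T at_) mem
  ...   | y , y∈ , eq = y , proj₂ (∈-filter⁻ (x ⊲?_) {xs = cells Λ} y∈) , sym eq

  step-view : (U : SYT Λ) (T : Tableau Λ) → ¬ Standard T →
    Σ[ x ∈ Cell Λ ] (Unsorted T x × step U T ≡ exchange T x)
  step-view U T ¬std with filter (unsorted? T) (cells Λ) in eq
  ... | [] = contradiction
    (sorted⇒standard T λ x uns → case-[] (subst (x ∈_) eq (∈-filter⁺ (unsorted? T) (∈-cells x) uns)))
    ¬std
    where
    case-[] : ∀ {x} → ¬ x ∈ ([] {A = Cell Λ})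
    case-[] ()
  ... | x ∷ xs = z , proj₂ (∈-filter⁻ (unsorted? T) {xs = cells Λ} (subst (z ∈_) (sym eq) z∈)) , refl
    where
    z : Cell Λ
    z = argmax (λ z → toℕ (tableau U at z)) x xs
    z∈ : z ∈ (x ∷ xs)
    z∈ with argmax-sel (λ z → toℕ (tableau U at z)) x xs
    ... | inj₁ e = here e
    ... | inj₂ m = there m

  transpose-at : {p q : Fin n} {T : Tableau Λ} {x : Cell Λ} → T at x ≢ p → T at x ≢ q →
    ↔-trans T (transpose p q) at x ≡ T at x
  transpose-at {p} {q} {T} {x} ≢p ≢q
    with T at x Fin.≟ p
  ... | yes e = contradiction e ≢p
  ... | no  _ with T at x Fin.≟ q
  ...   | yes e = contradiction e ≢q
  ...   | no  _ = refl

  -- Σ_x U(x) T(x), which grows with every exchange because the larger of the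
  -- two entries moves to the cell where U is larger.
  potential : SYT Λ → Tableau Λ → ℕ
  potential U T = Σᶠ {n} λ i → toℕ i * toℕ (T at cellOf (tableau U) i)

  potential-bound : (U : SYT Λ) (T : Tableau Λ) → potential U T ≤ n * (n * n)
  potential-bound U T = Σᶠ-bound _ λ i →
    ℕ.*-mono-≤ (ℕ.<⇒≤ (Fin.toℕ<n i)) (ℕ.<⇒≤ (Fin.toℕ<n (T at cellOf (tableau U) i)))

  potential-step : (U : SYT Λ) (T : Tableau Λ) → ¬ Standard T →
    potential U T < potential U (step U T)
  potential-step U T ¬std with step-view U T ¬std
  ... | x , uns , eq with unsorted⇒least T x uns
  ...   | y , x⊲y , Ty = subst (λ T′ → potential U T < potential U T′) (sym eq)
    (Σᶠ-swap (value T) (value T′) (u at x) (u at y) (⊲⇒< U x⊲y)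
      (subst₂ _<_ (sym (trans (value-at T y) (cong toℕ Ty))) (sym (value-at T x)) uns)
      (trans (value-at T′ x)
        (trans (cong toℕ (transpose-l (T at x) (least T x)))
          (sym (trans (value-at T y) (cong toℕ Ty)))))
      (trans (value-at T′ y)
        (trans (cong toℕ (trans (cong (Inverse.to (transpose (T at x) (least T x))) Ty)
                                (transpose-r (T at x) (least T x))))
          (sym (value-at T x))))
      λ j j≢x j≢y → sym (cong toℕ (transpose-at {T = T}
        (λ e → j≢x (from-≡ (at-injective T e)))
        (λ e → j≢y (from-≡ (at-injective T (trans e (sym Ty))))))))
    where
    u T′ : Tableau Λ
    u  = tableau U
    T′ = exchange T x
    value : Tableau Λ → Fin n → ℕ
    value S i = toℕ (S at cellOf u i)
    value-at : ∀ S z → value S (u at z) ≡ toℕ (S at z)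
    value-at S z = cong (λ w → toℕ (S at w)) (Inverse.strictlyInverseʳ u z)
    from-≡ : ∀ {j z} → cellOf u j ≡ z → j ≡ u at z
    from-≡ {j} e = trans (sym (Inverse.strictlyInverseˡ u j)) (cong (u at_) e)

  stops : (U : SYT Λ) (T : Tableau Λ) →
    ∃[ r ] (Standard (seq U T r) × (∀ s → s < r → ¬ Standard (seq U T s)))
  stops U T = search (suc (n * (n * n))) 0 (λ _ ()) (ℕ.m≤n+m _ _)
    where
    search : ∀ fuel s → (∀ s′ → s′ < s → ¬ Standard (seq U T s′)) →
      suc (n * (n * n)) ≤ potential U (seq U T s) + fuel →
      ∃[ r ] (Standard (seq U T r) × (∀ s → s < r → ¬ Standard (seq U T s)))
    search fuel s before enough with standard? (seq U T s)
    ... | yes std = s , std , before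
    search zero s before enough | no _ = contradiction
      (ℕ.≤-trans enough (ℕ.≤-trans (ℕ.≤-reflexive (ℕ.+-identityʳ _))
        (potential-bound U (seq U T s))))
      ℕ.1+n≰n
    search (suc fuel) s before enough | no ¬std = search fuel (suc s) before′
      (ℕ.≤-trans enough (ℕ.≤-trans (ℕ.≤-reflexive (ℕ.+-suc _ fuel))
        (ℕ.+-monoˡ-≤ fuel (potential-step U (seq U T s) ¬std))))
      where
      before′ : ∀ s′ → s′ < suc s → ¬ Standard (seq U T s′)
      before′ s′ s′<1+s with ℕ.m≤n⇒m<n∨m≡n (ℕ.≤-pred s′<1+s)
      ... | inj₁ s′<s = before s′ s′<s
      ... | inj₂ refl = ¬std

  r : SYT Λ → Tableau Λ → ℕ
  r U T = proj₁ (stops U T)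

  φ : SYT Λ → Tableau Λ → SYT Λ
  φ U T = record
    { tableau  = seq U T (r U T)
    ; standard = proj₁ (proj₂ (stops U T))
    }

  z : SYT Λ → SYT Λ → ℕ
  z U W = count λ T → tableau (φ U T) ≈? tableau W

  -- T_s and T_{s+1}, with s counted from 0, are the tableaux before and after
  -- the exchange.
  Exchanges : SYT Λ → (a b : Fin n) (x y : Cell Λ) → Tableau Λ → ℕ → Set
  Exchanges U a b x y T s =
    (seq U T s at x ≡ a × seq U T s at y ≡ b) ×
    (seq U T (suc s) at x ≡ b × seq U T (suc s) at y ≡ a)

  exchanges? : ∀ U a b x y T → Decidable (Exchanges U a b x y T)
  exchanges? U a b x y T s =
    ((seq U T s at x Fin.≟ a) ×-dec (seq U T s at y Fin.≟ b)) ×-dec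
    ((seq U T (suc s) at x Fin.≟ b) ×-dec (seq U T (suc s) at y Fin.≟ a))

  m : SYT Λ → (a b : Fin n) (x y : Cell Λ) → ℕ
  m U a b x y = count λ T → ℕ.anyUpTo? (exchanges? U a b x y T) (r U T)

  -- The numbers m U a b x y are the same for all b > a, so for b > a this is
  -- the signed exit number of a at x, whichever b is used.
  Δ : SYT Λ → (a b : Fin n) → Cell Λ → ℤ
  Δ U a b x =
    ℤ.+ sum (map (λ y → m U a b x y) (N⁻ x)) ℤ.- ℤ.+ sum (map (λ y → m U a b y x) (N⁺ x))

  -- Heights are natural numbers, so the default value 0 of max is harmless.
  β : SYT Λ → Fin n → Tableau Λ → ℕ
  β U b T = max 0 (map (λ i → height (cellOf (seq U T i) b)) (upTo (suc (r U T))))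

  Drops : SYT Λ → Fin n → Cell Λ → Tableau Λ → Set
  Drops U b x T = height x ≡ β U b T × ∃[ i ] (i < suc (r U T) × seq U T i at x ≡ b)

  drops? : ∀ U b x → Decidable (Drops U b x)
  drops? U b x T =
    (height x ℕ.≟ β U b T) ×-dec
    ℕ.anyUpTo? (λ i → seq U T i at x Fin.≟ b) (suc (r U T))

  d : SYT Λ → Fin n → Cell Λ → ℕ
  d U b x = count (drops? U b x)

-- The sum of f a over all entries a < b.
Σ< : {n : ℕ} → Fin n → (Fin n → ℤ) → ℤ
Σ< {n} b f = foldr ℤ._+_ 0ℤ (map f (filter (Fin._<? b) (allFin n)))

{-# OPTIONS --safe #-}
module Submission where

-- An exchange of the algorithm moves the greater of two entries down or right
-- and the smaller one up or left.  The algorithm treats the cells in the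
-- reverse order of U, and slides the initial entry of the cell under treatment
-- into the sorted cells after it.  Therefore an entry b waits in its initial
-- cell, then falls in exchanges with smaller entries, which increase along the
-- slide, and afterwards only rises in exchanges with greater entries.  This is
-- the content of `before`, which is read off an invariant of the run, `Slide`.
-- It follows that b falls from its initial cell to the cell of greatest height
-- that it ever occupies, the drop cell, and rises from there to its final cell
-- (`drop-cell`).
--
-- For a < b and a cell x let out(a,b) and in(a,b) be the numbers of exchanges
-- of a and b, over all tableaux, in which a leaves or enters x, so that b
-- enters or leaves x.  Counting how often b enters and leaves x gives
--
--   d(b,x) + sum over a < b of in(a,b)  =  (n-1)! + sum over a < b of out(a,b)
--   f(b,x) + sum over c > b of out(b,c) =  d(b,x) + sum over c > b of in(b,c)
--
-- where (n-1)! counts the tableaux with b at x (`tableaux-with`) and f(b,x)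
-- those whose sorted tableau has b at x (`fall-balance`, `rise-balance`).
--
-- The number of exchanges of a with b between two given cells is the same for
-- all b > a (`m-independent`): if σ moves b to b′ and keeps the order of the
-- other entries, then the runs from T and from σ ∘ T agree up to σ until b is
-- exchanged with a, because up to that time b waits or is exchanged with
-- entries smaller than a.  As out(a,b) - in(a,b) is the signed exit number of
-- a, the first balance is the formula for the drop function.
--
-- For the second claim, f is determined by the distribution vector
-- (`final-cong`).  If d(a,x) is known as well, then the second balance, with
-- a for b, determines the signed exit number of a, since its sums have equal
-- terms and are not empty as long as a is not the greatest entry.  The signed
-- exit numbers of all a < b determine d(b,x) by the first balance, and the
-- claim follows by induction on b.

open import Defs
open import Data.Fin as Fin using (Fin; zero; suc; toℕ; punchIn; punchOut)
import Data.Fin.Induction as Fin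
open import Data.Fin.Permutation as Perm
  using (Permutation′; _⟨$⟩ʳ_; _⟨$⟩ˡ_; id; insert; remove; transpose; flip)
import Data.Fin.Properties as Fin
open import Data.Integer as ℤ using (0ℤ)
import Data.Integer.Properties as ℤ
import Data.Integer.Solver as ℤ
open import Data.List
  using (List; []; _∷_; map; filter; length; concatMap; foldr; upTo; allFin)
import Data.List.Extrema as Extrema
open import Data.List.Extrema.Nat
  using (max; max≈v⁺; argmax; argmax-sel; f[⊥]≤f[argmax]; f[xs]≤f[argmax])
open import Data.List.Membership.Propositional using (_∈_)
open import Data.List.Membership.Propositional.Properties
  using (∈-filter⁺; ∈-filter⁻; ∈-map⁺; ∈-map⁻; ∈-upTo⁺; ∈-upTo⁻; ∈-allFin)
import Data.List.Properties as List
open import Data.List.Relation.Unary.All as All using (All)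
open import Data.List.Relation.Unary.AllPairs using (_∷_)
open import Data.List.Relation.Unary.Any using (here; there)
open import Data.List.Relation.Unary.Unique.Propositional using (Unique)
import Data.List.Relation.Unary.Unique.Propositional.Properties as Unique
open import Data.Nat as ℕ using (ℕ; zero; suc; _+_; _*_; _∸_; _!; _<_; _≤_; z≤n; s≤s)
open import Data.Nat.ListAction using (sum)
open import Data.Nat.ListAction.Properties using (sum-++)
import Data.Nat.Properties as ℕ
open import Data.Nat.Solver using (module +-*-Solver)
open import Data.Product using (Σ-syntax; ∃-syntax; _×_; _,_; proj₁; proj₂)
open import Data.Sum using (_⊎_; inj₁; inj₂)
open import Function using (_∘_; Inverse)
open import Function.Properties.Inverse using (↔-trans; ↔-sym)
import Induction.WellFounded as WF
import Level
open import Relation.Binary.Definitions using (tri<; tri≈; tri>)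
open import Relation.Binary.PropositionalEquality
  using (_≡_; _≢_; refl; sym; trans; cong; cong₂; subst; subst₂; module ≡-Reasoning)
open import Relation.Nullary using (Dec; yes; no; ¬_; contradiction)
open import Relation.Nullary.Decidable using (map′; _×-dec_)
open import Relation.Unary using (Decidable)

-- Indicators, sums and balances

private
  variable
    A B : Set
    P Q : Set

-- The indicator of a decidable proposition.
[_] : Dec P → ℕ
[ yes _ ] = 1
[ no  _ ] = 0

[]-cong : (P? : Dec P) (Q? : Dec Q) → (P → Q) → (Q → P) → [ P? ] ≡ [ Q? ]
[]-cong (yes _) (yes _) _ _ = refl
[]-cong (yes p) (no ¬q) f _ = contradiction (f p) ¬q
[]-cong (no ¬p) (yes q) _ g = contradiction (g q) ¬p
[]-cong (no _)  (no _)  _ _ = refl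

[]-yes : (P? : Dec P) → P → [ P? ] ≡ 1
[]-yes (yes _) _ = refl
[]-yes (no ¬p) p = contradiction p ¬p

[]-no : (P? : Dec P) → ¬ P → [ P? ] ≡ 0
[]-no (yes p) ¬p = contradiction p ¬p
[]-no (no _)  _  = refl

-- The sum of f x over the members x of xs.
∑ : List A → (A → ℕ) → ℕ
∑ xs f = sum (map f xs)

∑-cong∈ : (xs : List A) {f g : A → ℕ} → (∀ {x} → x ∈ xs → f x ≡ g x) → ∑ xs f ≡ ∑ xs g
∑-cong∈ []       _  = refl
∑-cong∈ (x ∷ xs) eq = cong₂ _+_ (eq (here refl)) (∑-cong∈ xs (eq ∘ there))

∑-cong : (xs : List A) {f g : A → ℕ} → (∀ x → f x ≡ g x) → ∑ xs f ≡ ∑ xs g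
∑-cong xs eq = ∑-cong∈ xs λ {x} _ → eq x

∑-0 : (xs : List A) {f : A → ℕ} → (∀ {x} → x ∈ xs → f x ≡ 0) → ∑ xs f ≡ 0
∑-0 []       _  = refl
∑-0 (x ∷ xs) eq = cong₂ _+_ (eq (here refl)) (∑-0 xs (eq ∘ there))

interchange : ∀ a b c d → (a + b) + (c + d) ≡ (a + c) + (b + d)
interchange = solve 4 (λ a b c d → (a :+ b) :+ (c :+ d) := (a :+ c) :+ (b :+ d)) refl
  where open +-*-Solver

∑-+ : (xs : List A) (f g : A → ℕ) → ∑ xs (λ x → f x + g x) ≡ ∑ xs f + ∑ xs g
∑-+ []       f g = refl
∑-+ (x ∷ xs) f g =
  trans (cong (f x + g x +_) (∑-+ xs f g)) (interchange (f x) (g x) (∑ xs f) (∑ xs g))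

∑-swap : (xs : List A) (ys : List B) (f : A → B → ℕ) →
  ∑ xs (λ x → ∑ ys (f x)) ≡ ∑ ys (λ y → ∑ xs (λ x → f x y))
∑-swap []       ys f = sym (∑-0 ys λ _ → refl)
∑-swap (x ∷ xs) ys f =
  trans (cong (∑ ys (f x) +_) (∑-swap xs ys f)) (sym (∑-+ ys (f x) _))

∑-*ˡ : (xs : List A) (k : ℕ) (f : A → ℕ) → ∑ xs (λ x → k * f x) ≡ k * ∑ xs f
∑-*ˡ []       k f = sym (ℕ.*-zeroʳ k)
∑-*ˡ (x ∷ xs) k f =
  trans (cong (k * f x +_) (∑-*ˡ xs k f)) (sym (ℕ.*-distribˡ-+ k (f x) (∑ xs f)))

∑-const : (xs : List A) (k : ℕ) → ∑ xs (λ _ → k) ≡ length xs * k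
∑-const []       k = refl
∑-const (_ ∷ xs) k = cong (k +_) (∑-const xs k)

∑-map : (g : A → B) (xs : List A) (f : B → ℕ) → ∑ (map g xs) f ≡ ∑ xs (f ∘ g)
∑-map g xs f = cong sum (sym (List.map-∘ xs))

∑-concatMap : (g : A → List B) (xs : List A) (f : B → ℕ) →
  ∑ (concatMap g xs) f ≡ ∑ xs (λ x → ∑ (g x) f)
∑-concatMap g []       f = refl
∑-concatMap g (x ∷ xs) f =
  trans (cong sum (List.map-++ f (g x) (concatMap g xs)))
    (trans (sum-++ (map f (g x)) _) (cong (∑ (g x) f +_) (∑-concatMap g xs f)))

∑-single : {xs : List A} {f : A → ℕ} {x : A} → Unique xs → x ∈ xs →
  (∀ {y} → y ∈ xs → y ≢ x → f y ≡ 0) → ∑ xs f ≡ f x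
∑-single {xs = _ ∷ xs} {f} {x} (fresh ∷ _) (here refl) zero′ =
  trans (cong (f x +_) (∑-0 xs λ y∈ → zero′ (there y∈) λ { refl → All.lookup fresh y∈ refl }))
    (ℕ.+-identityʳ (f x))
∑-single (fresh ∷ unique) (there x∈) zero′ =
  cong₂ _+_ (zero′ (here refl) λ { refl → All.lookup fresh x∈ refl })
    (∑-single unique x∈ (zero′ ∘ there))

length-filter : {P : A → Set} (P? : Decidable P) (xs : List A) →
  length (filter P? xs) ≡ ∑ xs (λ x → [ P? x ])
length-filter P? []       = refl
length-filter P? (x ∷ xs) with P? x
... | yes _ = cong suc (length-filter P? xs)
... | no  _ = length-filter P? xs

-- A family of propositions, of which at most the one at (x₀ , y₀) holds, and
-- this one iff Q.
∑∑-indicator : {xs : List A} {ys : List B} {P : A → B → Set}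
  (P? : ∀ x y → Dec (P x y)) (Q? : Dec Q) {x₀ : A} {y₀ : B} →
  Unique xs → Unique ys →
  (∀ {x y} → x ∈ xs → y ∈ ys → P x y → Q × x ≡ x₀ × y ≡ y₀) →
  (Q → x₀ ∈ xs × y₀ ∈ ys × P x₀ y₀) →
  ∑ xs (λ x → ∑ ys (λ y → [ P? x y ])) ≡ [ Q? ]
∑∑-indicator {xs = xs} {ys} P? (no ¬q) _ _ only _ =
  ∑-0 xs λ x∈ → ∑-0 ys λ y∈ → []-no (P? _ _) λ p → ¬q (proj₁ (only x∈ y∈ p))
∑∑-indicator {xs = xs} {ys} P? (yes q) {x₀} {y₀} uxs uys only holds with holds q
... | x₀∈ , y₀∈ , p =
  trans (∑-single uxs x₀∈ λ x∈ x≢ → ∑-0 ys λ y∈ → []-no (P? _ _) λ p′ →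
          x≢ (proj₁ (proj₂ (only x∈ y∈ p′))))
    (trans (∑-single uys y₀∈ λ y∈ y≢ → []-no (P? _ _) λ p′ →
             y≢ (proj₂ (proj₂ (only x₀∈ y∈ p′))))
      ([]-yes (P? x₀ y₀) p))

-- The sum of f s over s < t.
∑< : ℕ → (ℕ → ℕ) → ℕ
∑< zero    f = 0
∑< (suc t) f = ∑< t f + f t

∑<-∑ : (t : ℕ) (xs : List A) (f : ℕ → A → ℕ) →
  ∑< t (λ s → ∑ xs (f s)) ≡ ∑ xs (λ x → ∑< t (λ s → f s x))
∑<-∑ zero    xs f = sym (∑-0 xs λ _ → refl)
∑<-∑ (suc t) xs f =
  trans (cong (_+ ∑ xs (f t)) (∑<-∑ t xs f)) (sym (∑-+ xs _ (f t)))

∑<-0 : (t : ℕ) {f : ℕ → ℕ} → (∀ {s} → s < t → f s ≡ 0) → ∑< t f ≡ 0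
∑<-0 zero    _  = refl
∑<-0 (suc t) eq = cong₂ _+_ (∑<-0 t λ s<t → eq (ℕ.m<n⇒m<1+n s<t)) (eq (ℕ.n<1+n t))

-- Counting the times at which an event happens that happens at most once.
∑<-once : {P : ℕ → Set} (P? : Decidable P) (t : ℕ) →
  (∀ {s s′} → s < s′ → P s → ¬ P s′) →
  [ ℕ.anyUpTo? P? t ] ≡ ∑< t (λ s → [ P? s ])
∑<-once P? zero    _    = refl
∑<-once P? (suc t) once with P? t | ℕ.anyUpTo? P? t | ∑<-once P? t once
... | yes p | _                   | _  =
  sym (cong (_+ 1) (∑<-0 t λ {s} s<t → []-no (P? s) λ p′ → once s<t p′ p))
... | no _  | yes (s , s<t , p)   | eq = trans eq (sym (ℕ.+-identityʳ _))
... | no _  | no _                | eq = trans eq (sym (ℕ.+-identityʳ _))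

foldr-difference : (xs : List A) (f g : A → ℕ) →
  foldr ℤ._+_ 0ℤ (map (λ x → ℤ.+ f x ℤ.- ℤ.+ g x) xs) ≡ ℤ.+ ∑ xs f ℤ.- ℤ.+ ∑ xs g
foldr-difference []       f g = refl
foldr-difference (x ∷ xs) f g = begin
  (+ f x - + g x) ℤ.+ foldr ℤ._+_ 0ℤ (map (λ y → + f y - + g y) xs)
    ≡⟨ cong (ℤ._+_ (+ f x - + g x)) (foldr-difference xs f g) ⟩
  (+ f x - + g x) ℤ.+ (+ ∑ xs f - + ∑ xs g)
    ≡⟨ ℤsolve 4 (λ a b c e → (a :- b) :+ (c :- e) := (a :+ c) :- (b :+ e)) refl
         (+ f x) (+ g x) (+ ∑ xs f) (+ ∑ xs g) ⟩
  (+ (f x + ∑ xs f) - + (g x + ∑ xs g)) ∎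
  where
  open ≡-Reasoning
  open import Data.Integer using (+_; _-_)
  open ℤ.+-*-Solver renaming (solve to ℤsolve)

difference : ∀ e i k o → e + i ≡ k + o → ℤ.+ e ≡ ℤ.+ k ℤ.+ (ℤ.+ o ℤ.- ℤ.+ i)
difference e i k o eq = begin
  ℤ.+ e
    ≡⟨ solve 2 (λ e i → e := (e :+ i) :- i) refl (ℤ.+ e) (ℤ.+ i) ⟩
  ℤ.+ (e + i) ℤ.- ℤ.+ i
    ≡⟨ cong (λ s → ℤ.+ s ℤ.- ℤ.+ i) eq ⟩
  ℤ.+ (k + o) ℤ.- ℤ.+ i
    ≡⟨ ℤ.+-assoc (ℤ.+ k) (ℤ.+ o) (ℤ.- ℤ.+ i) ⟩
  ℤ.+ k ℤ.+ (ℤ.+ o ℤ.- ℤ.+ i) ∎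
  where
  open ≡-Reasoning
  open ℤ.+-*-Solver

∑-constant : (as : List A) {f : A → ℕ} {p : ℕ} →
  (∀ {a} → a ∈ as → f a ≡ p) → ∑ as f ≡ length as * p
∑-constant as {p = p} eq = trans (∑-cong∈ as eq) (∑-const as p)

-- An equation of flows all of whose terms are equal.
constant-flow : (as : List A) {o i : A → ℕ} {f g p q : ℕ} →
  f + ∑ as o ≡ g + ∑ as i → (∀ {a} → a ∈ as → o a ≡ p) → (∀ {a} → a ∈ as → i a ≡ q) →
  f + length as * p ≡ g + length as * q
constant-flow as {f = f} {g} eq o≡ i≡ =
  trans (cong (f +_) (sym (∑-constant as o≡))) (trans eq (cong (g +_) (∑-constant as i≡)))

-- Two equations f + o = g + i with the same f and g have the same o - i.
cross : ∀ {f g o o′ i i′} → f + o ≡ g + i → f + o′ ≡ g + i′ → o + i′ ≡ o′ + i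
cross {f} {g} {o} {o′} {i} {i′} eq eq′ = ℕ.+-cancelˡ-≡ (f + g) _ _ (begin
  (f + g) + (o + i′)  ≡⟨ interchange f g o i′ ⟩
  (f + o) + (g + i′)  ≡⟨ cong₂ _+_ eq (sym eq′) ⟩
  (g + i) + (f + o′)  ≡⟨ ℕ.+-comm (g + i) (f + o′) ⟩
  (f + o′) + (g + i)  ≡⟨ interchange f o′ g i ⟩
  (f + g) + (o′ + i)  ∎)
  where open ≡-Reasoning

cross-multiple : {a : A} {as : List A} → a ∈ as → ∀ {f f′ g g′ o o′ i i′} →
  f + length as * o ≡ g + length as * i → f′ + length as * o′ ≡ g′ + length as * i′ →
  f ≡ f′ → g ≡ g′ → o + i′ ≡ o′ + i
cross-multiple {as = as@(_ ∷ _)} _ {f} {_} {g} {_} {o} {o′} {i} {i′} eq eq′ refl refl =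
  ℕ.*-cancelˡ-≡ (o + i′) (o′ + i) (length as) (begin
    length as * (o + i′)             ≡⟨ ℕ.*-distribˡ-+ (length as) o i′ ⟩
    length as * o + length as * i′   ≡⟨ cross {f} {g} eq eq′ ⟩
    length as * o′ + length as * i   ≡⟨ sym (ℕ.*-distribˡ-+ (length as) o′ i) ⟩
    length as * (o′ + i)             ∎)
  where open ≡-Reasoning

-- If the differences o - i and o′ - i′ agree term by term, then so do the
-- quantities e and e′ which they determine.
∑-cross : (as : List A) {o o′ i i′ : A → ℕ} {e e′ k : ℕ} →
  e + ∑ as i ≡ k + ∑ as o → e′ + ∑ as i′ ≡ k + ∑ as o′ →
  (∀ {a} → a ∈ as → o a + i′ a ≡ o′ a + i a) → e ≡ e′
∑-cross as {o} {o′} {i} {i′} {e} {e′} {k} eq eq′ crossed =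
  ℕ.+-cancelʳ-≡ (∑ as i + ∑ as o′) e e′ (begin
    e + (∑ as i + ∑ as o′)   ≡⟨ sym (ℕ.+-assoc e (∑ as i) (∑ as o′)) ⟩
    (e + ∑ as i) + ∑ as o′   ≡⟨ cong (_+ ∑ as o′) eq ⟩
    (k + ∑ as o) + ∑ as o′   ≡⟨ rearrange k (∑ as o) (∑ as o′) ⟩
    (k + ∑ as o′) + ∑ as o   ≡⟨ cong (_+ ∑ as o) (sym eq′) ⟩
    (e′ + ∑ as i′) + ∑ as o  ≡⟨ ℕ.+-assoc e′ (∑ as i′) (∑ as o) ⟩
    e′ + (∑ as i′ + ∑ as o)  ≡⟨ cong (e′ +_) exits ⟩
    e′ + (∑ as i + ∑ as o′)  ∎)
  where
  open ≡-Reasoning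
  rearrange : ∀ k p q → (k + p) + q ≡ (k + q) + p
  rearrange = solve 3 (λ k p q → (k :+ p) :+ q := (k :+ q) :+ p) refl
    where open +-*-Solver
  exits : ∑ as i′ + ∑ as o ≡ ∑ as i + ∑ as o′
  exits = trans (ℕ.+-comm (∑ as i′) (∑ as o)) (trans (sym (∑-+ as o i′))
    (trans (∑-cong∈ as crossed) (trans (∑-+ as o′ i) (ℕ.+-comm (∑ as o′) (∑ as i)))))

signed-sum : (as : List A) {f f′ g g′ : A → ℕ} {e k : ℕ} →
  e + ∑ as g ≡ k + ∑ as f →
  (∀ {a} → a ∈ as → f a ≡ f′ a) → (∀ {a} → a ∈ as → g a ≡ g′ a) →
  ℤ.+ e ≡ ℤ.+ k ℤ.+ foldr ℤ._+_ 0ℤ (map (λ a → ℤ.+ f′ a ℤ.- ℤ.+ g′ a) as)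
signed-sum as {f} {f′} {g} {g′} {e} {k} eq f≡ g≡ = begin
  ℤ.+ e
    ≡⟨ difference e (∑ as g) k (∑ as f) eq ⟩
  ℤ.+ k ℤ.+ (ℤ.+ ∑ as f ℤ.- ℤ.+ ∑ as g)
    ≡⟨ cong₂ (λ o i → ℤ.+ k ℤ.+ (ℤ.+ o ℤ.- ℤ.+ i)) (∑-cong∈ as f≡) (∑-cong∈ as g≡) ⟩
  ℤ.+ k ℤ.+ (ℤ.+ ∑ as f′ ℤ.- ℤ.+ ∑ as g′)
    ≡⟨ cong (ℤ._+_ (ℤ.+ k)) (sym (foldr-difference as f′ g′)) ⟩
  ℤ.+ k ℤ.+ foldr ℤ._+_ 0ℤ (map (λ a → ℤ.+ f′ a ℤ.- ℤ.+ g′ a) as) ∎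
  where open ≡-Reasoning

-- A quantity was k₀ before the flows out and in, and is k after them.  As a
-- record, this lets the four numbers be inferred.
record Balance (k out k₀ in′ : ℕ) : Set where
  constructor balanced
  field
    balance : k + out ≡ k₀ + in′

module _ {k out k₀ in′ : ℕ} where

  balance-rest : {o i : ℕ} → i ≡ 0 → o ≡ 0 →
    Balance k out k₀ in′ → Balance k (out + o) k₀ (in′ + i)
  balance-rest refl refl (balanced eq) = balanced
    (trans (cong (k +_) (ℕ.+-identityʳ out)) (trans eq (cong (k₀ +_) (sym (ℕ.+-identityʳ in′)))))

  -- The whole quantity k leaves, and k′ enters.
  balance-move : {k′ o i : ℕ} → i ≡ k′ → o ≡ k →
    Balance k out k₀ in′ → Balance k′ (out + o) k₀ (in′ + i)
  balance-move {k′} refl refl (balanced eq) = balanced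
    (trans (solve 3 (λ k′ o k → k′ :+ (o :+ k) := (k :+ o) :+ k′) refl k′ out k)
      (trans (cong (_+ k′) eq) (ℕ.+-assoc k₀ in′ k′)))
    where open +-*-Solver

  balance-now : {k′ : ℕ} → k′ ≡ k → Balance k out k₀ in′ → Balance k′ out k₀ in′
  balance-now refl bal = bal

  balance-then : {k₁ : ℕ} → k₀ ≡ k₁ → Balance k out k₀ in′ → Balance k out k₁ in′
  balance-then refl bal = bal

  -- If nothing has changed so far, then both sides may be replaced alike.
  balance-shift : {k′ k₁ : ℕ} → k ≡ k₀ → k′ ≡ k₁ → Balance k out k₀ in′ → Balance k′ out k₁ in′
  balance-shift {k′} refl refl (balanced eq) = balanced (cong (k′ +_) (ℕ.+-cancelˡ-≡ k _ _ eq))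

-- Steps of the algorithm

-- The step of the algorithm from T exchanges the entries of x and y: in the
-- order of U, no cell after x holds a greater entry than a neighbour below or
-- to the right, and y holds the least entry among these neighbours of x.
record Move {n : ℕ} {Λ : Partition n} (U : SYT Λ) (T : Tableau Λ) (x y : Cell Λ) : Set where
  field
    adjacent : x ⊲ y
    descent  : T at y Fin.< T at x
    minimal  : ∀ {w} → x ⊲ w → T at y Fin.≤ T at w
    maximal  : ∀ {w v} → tableau U at x Fin.< tableau U at w → w ⊲ v → T at w Fin.< T at v

open Move

-- T′ arises from T by exchanging the entries of x and y.
record Swapped {n : ℕ} {Λ : Partition n} (T T′ : Tableau Λ) (x y : Cell Λ) : Set where
  field
    at-x  : T′ at x ≡ T at y
    at-y  : T′ at y ≡ T at x
    other : ∀ {w} → w ≢ x → w ≢ y → T′ at w ≡ T at w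

open Swapped

-- The step of the algorithm leads from T to T′, up to pointwise equality.  A
-- standard tableau is left unchanged.
data Next {n : ℕ} {Λ : Partition n} (U : SYT Λ) (T T′ : Tableau Λ) : Set where
  rest : Standard T → (∀ w → T′ at w ≡ T at w) → Next U T T′
  move : ∀ {x y} → Move U T x y → Swapped T T′ x y → Next U T T′

module _ {n : ℕ} {Λ : Partition n} where

  _≟ᶜ_ : (x y : Cell Λ) → Dec (x ≡ y)
  x ≟ᶜ y = map′ (at-injective (reading Λ)) (cong (reading Λ at_))
             (reading Λ at x Fin.≟ reading Λ at y)

  standard⇒increasing : {T : Tableau Λ} → Standard T → ∀ {x y} → x ⊲ y → T at x Fin.< T at y
  standard⇒increasing {T} std = ⊲⇒< (record { tableau = T ; standard = std })

  least≤ : (T : Tableau Λ) {x w : Cell Λ} → x ⊲ w → least T x Fin.≤ T at w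
  least≤ T {x} {w} x⊲w =
    All.lookup (Extrema.min≤xs (Fin.≤-totalOrder n) (T at x) (map (T at_) (N⁺ x)))
      (∈-map⁺ (T at_) (∈-filter⁺ (x ⊲?_) (∈-cells w) x⊲w))

  at-≢ : (T : Tableau Λ) {x y : Cell Λ} → x ≢ y → T at x ≢ T at y
  at-≢ T x≢y = x≢y ∘ at-injective T

  ≤∧≢⇒at< : (T : Tableau Λ) {x y : Cell Λ} → x ≢ y → T at x Fin.≤ T at y → T at x Fin.< T at y
  ≤∧≢⇒at< T x≢y le = Fin.≤∧≢⇒< le (at-≢ T x≢y)

  ¬unsorted⇒< : (T : Tableau Λ) {x y : Cell Λ} → ¬ Unsorted T x → x ⊲ y → T at x Fin.< T at y
  ¬unsorted⇒< T {x} sorted x⊲y =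
    ≤∧≢⇒at< T (λ { refl → ⊲-irrefl {x = x} x⊲y }) (ℕ.≤-trans (ℕ.≮⇒≥ sorted) (least≤ T x⊲y))

  <⇒≢ : (T : Tableau Λ) {x y : Cell Λ} → T at x Fin.< T at y → x ≢ y
  <⇒≢ T lt refl = ℕ.<-irrefl refl lt

module _ {n : ℕ} {Λ : Partition n} (U : SYT Λ) where

  private
    u : Cell Λ → Fin n
    u x = tableau U at x

  -- The step of the algorithm, with the list of the unsorted cells as an argument.
  step-among : Tableau Λ → List (Cell Λ) → Tableau Λ
  step-among T []       = T
  step-among T (x ∷ xs) = exchange T (argmax (toℕ ∘ u) x xs)

  step≡step-among : (T : Tableau Λ) →
    step U T ≡ step-among T (filter (unsorted? T) (cells Λ))
  step≡step-among T with filter (unsorted? T) (cells Λ)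
  ... | []    = refl
  ... | _ ∷ _ = refl

  step-among-next : (T : Tableau Λ) (xs : List (Cell Λ)) →
    (∀ {x} → x ∈ xs → Unsorted T x) → (∀ {x} → Unsorted T x → x ∈ xs) →
    Next U T (step-among T xs)
  step-among-next T [] _ complete = rest (sorted⇒standard T λ x uns → ∉[] (complete uns)) λ _ → refl
    where
    ∉[] : {x : Cell Λ} → ¬ x ∈ []
    ∉[] ()
  step-among-next T (x₀ ∷ xs) sound complete = move moved swapped
    where
    x y : Cell Λ
    x = argmax (toℕ ∘ u) x₀ xs
    x∈ : x ∈ (x₀ ∷ xs)
    x∈ with argmax-sel (toℕ ∘ u) x₀ xs
    ... | inj₁ e = here e
    ... | inj₂ m = there m
    ≤x : ∀ {w} → w ∈ (x₀ ∷ xs) → u w Fin.≤ u x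
    ≤x (here refl) = f[⊥]≤f[argmax] {f = toℕ ∘ u} x₀ xs
    ≤x (there w∈)  = All.lookup (f[xs]≤f[argmax] {f = toℕ ∘ u} x₀ xs) w∈
    neighbour : Σ[ y ∈ Cell Λ ] (x ⊲ y × T at y ≡ least T x)
    neighbour = unsorted⇒least T x (sound x∈)
    y = proj₁ neighbour
    Ty : T at y ≡ least T x
    Ty = proj₂ (proj₂ neighbour)
    moved : Move U T x y
    moved .adjacent = proj₁ (proj₂ neighbour)
    moved .descent = subst (Fin._< T at x) (sym Ty) (sound x∈)
    moved .minimal {w} x⊲w = subst (Fin._≤ T at w) (sym Ty) (least≤ T x⊲w)
    moved .maximal {w} x<w = ¬unsorted⇒< T λ uns → ℕ.<⇒≱ x<w (≤x (complete uns))
    swapped : Swapped T (exchange T x) x y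
    swapped .at-x = trans (transpose-l (T at x) (least T x)) (sym Ty)
    swapped .at-y = trans (cong (Inverse.to (transpose (T at x) (least T x))) Ty)
                      (transpose-r (T at x) (least T x))
    swapped .other w≢x w≢y = transpose-at {T = T} (at-≢ T w≢x)
      (λ e → at-≢ T w≢y (trans e (sym Ty)))

  step-next : (T : Tableau Λ) → Next U T (step U T)
  step-next T = subst (Next U T) (sym (step≡step-among T))
    (step-among-next T (filter (unsorted? T) (cells Λ))
      (λ x∈ → proj₂ (∈-filter⁻ (unsorted? T) {xs = cells Λ} x∈))
      (λ {x} uns → ∈-filter⁺ (unsorted? T) (∈-cells x) uns))

-- The tableaux S and σ ∘ T are the same.
infix 4 _≈[_]_
_≈[_]_ : {n : ℕ} {Λ : Partition n} → Tableau Λ → Permutation′ n → Tableau Λ → Set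
S ≈[ σ ] T = ∀ w → S at w ≡ σ ⟨$⟩ʳ (T at w)

module _ {n : ℕ} {Λ : Partition n} {U : SYT Λ} where

  private
    u : Cell Λ → Fin n
    u x = tableau U at x

  Move⇒height< : {T : Tableau Λ} {x y : Cell Λ} → Move U T x y → height x < height y
  Move⇒height< {x = x} {y} mv with adjacent mv
  ... | inj₁ (r , c) = ℕ.≤-reflexive (sym (cong₂ _+_ r c))
  ... | inj₂ (r , c) = ℕ.≤-reflexive (sym (trans (cong₂ _+_ r c) (ℕ.+-suc (row x) (col x))))

  Move⇒¬Standard : {T : Tableau Λ} {x y : Cell Λ} → Move U T x y → ¬ Standard T
  Move⇒¬Standard {T} mv std =
    ℕ.<-asym (descent mv) (standard⇒increasing {T = T} std (adjacent mv))

  Move-unique : {T : Tableau Λ} {x y x′ y′ : Cell Λ} →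
    Move U T x y → Move U T x′ y′ → x ≡ x′ × y ≡ y′
  Move-unique {T} {x} {y} {x′} {y′} mv mv′ with Fin.<-cmp (u x) (u x′)
  ... | tri< lt _ _ = contradiction (descent mv′) (ℕ.<-asym (maximal mv lt (adjacent mv′)))
  ... | tri> _ _ gt = contradiction (descent mv) (ℕ.<-asym (maximal mv′ gt (adjacent mv)))
  ... | tri≈ _ eq _ with at-injective (tableau U) eq
  ...   | refl = refl , at-injective T
                   (Fin.≤-antisym (minimal mv (adjacent mv′)) (minimal mv′ (adjacent mv)))

  Move⇒Swapped : {T T′ : Tableau Λ} {x y : Cell Λ} → Next U T T′ → Move U T x y →
    Swapped T T′ x y
  Move⇒Swapped {T} (rest std _) mv = contradiction std (Move⇒¬Standard {T = T} mv)
  Move⇒Swapped (move mv′ sw) mv with Move-unique mv mv′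
  ... | refl , refl = sw

  Standard⇒rest : {T T′ : Tableau Λ} → Next U T T′ → Standard T → ∀ w → T′ at w ≡ T at w
  Standard⇒rest (rest _ eq)       std = eq
  Standard⇒rest {T} (move mv _) std = contradiction std (Move⇒¬Standard {T = T} mv)

  Swapped-relabel : {S S′ T T′ : Tableau Λ} {x y : Cell Λ} {σ : Permutation′ n} →
    Swapped T T′ x y → Swapped S S′ x y → S ≈[ σ ] T → S′ ≈[ σ ] T′
  Swapped-relabel {x = x} {y} {σ} sw sw′ eq w with w ≟ᶜ x | w ≟ᶜ y
  ... | yes refl | _        = trans (at-x sw′) (trans (eq y) (cong (σ ⟨$⟩ʳ_) (sym (at-x sw))))
  ... | no _     | yes refl = trans (at-y sw′) (trans (eq x) (cong (σ ⟨$⟩ʳ_) (sym (at-y sw))))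
  ... | no w≢x   | no w≢y   =
    trans (other sw′ w≢x w≢y) (trans (eq w) (cong (σ ⟨$⟩ʳ_) (sym (other sw w≢x w≢y))))

  Standard-≈ : {T T′ : Tableau Λ} → T′ ≈ T → Standard T → Standard T′
  Standard-≈ eq (rows , cols) =
    (λ x y r c → subst₂ Fin._<_ (sym (eq x)) (sym (eq y)) (rows x y r c)) ,
    (λ x y c r → subst₂ Fin._<_ (sym (eq x)) (sym (eq y)) (cols x y c r))

  Move-≈ : {T T′ : Tableau Λ} {x y : Cell Λ} → T′ ≈ T → Move U T x y → Move U T′ x y
  Move-≈ {x = x} {y} eq mv = record
    { adjacent = adjacent mv
    ; descent  = subst₂ Fin._<_ (sym (eq y)) (sym (eq x)) (descent mv)
    ; minimal  = λ {w} x⊲w → subst₂ Fin._≤_ (sym (eq y)) (sym (eq w)) (minimal mv x⊲w)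
    ; maximal  = λ {w} {v} lt w⊲v →
        subst₂ Fin._<_ (sym (eq w)) (sym (eq v)) (maximal mv lt w⊲v)
    }

  Next-≈ : {S S′ T T′ : Tableau Λ} → Next U T T′ → Next U S S′ → S ≈ T → S′ ≈ T′
  Next-≈ {S} {S′} {T} {T′} (rest std e) nx eq w =
    trans (Standard⇒rest nx (Standard-≈ {T} {S} eq std) w) (trans (eq w) (sym (e w)))
  Next-≈ {S} {S′} {T} {T′} (move mv sw) nx eq =
    Swapped-relabel {S} {S′} {T} {T′} {σ = id} sw (Move⇒Swapped nx (Move-≈ {T} {S} eq mv)) eq

-- The entries a at x and b at y are exchanged between T and T′.
Exchanged : {n : ℕ} {Λ : Partition n} (T T′ : Tableau Λ) (a b : Fin n) (x y : Cell Λ) → Set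
Exchanged T T′ a b x y = (T at x ≡ a × T at y ≡ b) × (T′ at x ≡ b × T′ at y ≡ a)

exchanged? : {n : ℕ} {Λ : Partition n} (T T′ : Tableau Λ) (a b : Fin n) (x y : Cell Λ) →
  Dec (Exchanged T T′ a b x y)
exchanged? T T′ a b x y =
  ((T at x Fin.≟ a) ×-dec (T at y Fin.≟ b)) ×-dec ((T′ at x Fin.≟ b) ×-dec (T′ at y Fin.≟ a))

module _ {n : ℕ} {Λ : Partition n} {U : SYT Λ} {T T′ : Tableau Λ} where

  -- The greater entry b moves from y to x.
  Exchanged⇒Move : Next U T T′ → {a b : Fin n} {x y : Cell Λ} → a Fin.< b →
    Exchanged T T′ a b x y → Move U T y x
  Exchanged⇒Move (rest _ e) a<b ((Tx , _) , (T′x , _)) =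
    contradiction (trans (sym Tx) (trans (sym (e _)) T′x)) (Fin.<⇒≢ a<b)
  Exchanged⇒Move (move {p} {q} mv sw) {x = x} a<b ((Tx , Ty) , (T′x , _))
    with x ≟ᶜ p | x ≟ᶜ q
  ... | yes refl | _ = contradiction (descent mv)
    (ℕ.<-asym (subst₂ Fin._<_ (sym Tx) (trans (sym T′x) (at-x sw)) a<b))
  ... | no x≢p | no x≢q =
    contradiction (trans (sym Tx) (trans (sym (other sw x≢p x≢q)) T′x)) (Fin.<⇒≢ a<b)
  ... | no _   | yes refl with at-injective T (trans Ty (trans (sym T′x) (at-y sw)))
  ...   | refl = mv

  Swapped⇒Exchanged : {a b : Fin n} {x y : Cell Λ} → Swapped T T′ y x →
    T at x ≡ a → T at y ≡ b → Exchanged T T′ a b x y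
  Swapped⇒Exchanged sw Tx Ty = (Tx , Ty) , (trans (at-y sw) Ty , trans (at-x sw) Tx)

-- A run of the algorithm: a sequence of tableaux, each of which arises from the
-- preceding one by a step, and which is constant from the first standard
-- tableau on.
record Run {n : ℕ} {Λ : Partition n} (U : SYT Λ) : Set where
  constructor _,_
  field
    run  : ℕ → Tableau Λ
    next : ∀ s → Next U (run s) (run (suc s))

module _ {n : ℕ} {Λ : Partition n} {U : SYT Λ} (R : Run U) where

  open Run R

  Standard-stays : {s : ℕ} → Standard (run s) → ∀ k → Standard (run (k + s))
  Standard-stays     std zero    = std
  Standard-stays {s} std (suc k) = Standard-≈ {U = U} {run (k + s)} {run (suc k + s)}
    (Standard⇒rest (next (k + s)) (Standard-stays std k)) (Standard-stays std k)

  ¬Standard⇒< : {s t : ℕ} → Standard (run t) → ¬ Standard (run s) → s < t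
  ¬Standard⇒< {s} {t} std ¬std = ℕ.≰⇒> λ t≤s →
    ¬std (subst (λ i → Standard (run i)) (ℕ.m∸n+n≡m t≤s) (Standard-stays std (s ℕ.∸ t)))

-- Slides

module Slides {n : ℕ} {Λ : Partition n} {U : SYT Λ} (R : Run U) where

  open Run R

  private
    u : Cell Λ → Fin n
    u x = tableau U at x

  -- What is known at time t, when the entry from c is at x, about an exchange
  -- between x′ and y′ at an earlier time s.  Either the entry from c was already
  -- sliding, and then the entry which it passed is less than those which are
  -- now below and to the right of x; or the slide from c had not begun, and
  -- x′ comes after the cells up to c, which still held their initial entries.
  data Past (t : ℕ) (c x : Cell Λ) (s : ℕ) (x′ y′ : Cell Λ) : Set where
    same-slide    : run s at x′ ≡ run 0 at c → u c Fin.≤ u x′ →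
                    (∀ {w} → u w Fin.< u c → run s at w ≡ run 0 at w) →
                    (∀ {v} → x ⊲ v → run s at y′ Fin.< run t at v) → Past t c x s x′ y′
    earlier-slide : (∀ {w} → u w Fin.≤ u c → u w Fin.< u x′ × run s at w ≡ run 0 at w) →
                    Past t c x s x′ y′

  -- At time t the initial entry of c, which was the last one to slide, is at x.
  -- The cells before c hold their initial entries, and those from c on, other
  -- than x, are sorted.
  record Slide (t : ℕ) (c x : Cell Λ) : Set where
    field
      origin    : run t at x ≡ run 0 at c
      beyond    : u c Fin.≤ u x
      untouched : ∀ {w} → u w Fin.< u c → run t at w ≡ run 0 at w
      sorted    : ∀ {w v} → u c Fin.≤ u w → w ≢ x → w ⊲ v → run t at w Fin.< run t at v
      -- The entries above and to the left of x are less than those below and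
      -- to the right of x, so that one of the latter may take the place of x.
      bypass    : ∀ {w v} → u c Fin.≤ u w → w ⊲ x → x ⊲ v → run t at w Fin.< run t at v
      past      : ∀ {s x′ y′} → s < t → Move U (run s) x′ y′ → Past t c x s x′ y′

  open Slide

  private
    ⊲⇒u< : {x y : Cell Λ} → x ⊲ y → u x Fin.< u y
    ⊲⇒u< = ⊲⇒< U

    u<⇒≢ : {x y : Cell Λ} → u x Fin.< u y → x ≢ y
    u<⇒≢ = <⇒≢ (tableau U)

  -- The sorting begins in the last cell, from which the entry cannot move.
  slide-start : {c : Cell Λ} → (∀ w → u w Fin.≤ u c) → Slide 0 c c
  slide-start greatest = record
    { origin    = refl
    ; beyond    = ℕ.≤-refl
    ; untouched = λ _ → refl
    ; sorted    = λ {w} c≤w w≢c → contradiction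
                    (at-injective (tableau U) (Fin.≤-antisym (greatest w) c≤w)) w≢c
    ; bypass    = λ c≤w w⊲c → contradiction c≤w (ℕ.<⇒≱ (⊲⇒u< w⊲c))
    ; past      = λ ()
    }

  slide-step : ∀ {t c x y} → Slide t c x → Move U (run t) x y → Slide (suc t) c y
  slide-step {t} {c} {x} {y} sl mv = record
    { origin    = trans (at-y sw) (origin sl)
    ; beyond    = c≤y
    ; untouched = λ w<c → trans (other sw (u<⇒≢ (ℕ.<-≤-trans w<c (beyond sl)))
                                          (u<⇒≢ (ℕ.<-≤-trans w<c c≤y)))
                            (untouched sl w<c)
    ; sorted    = sorted′
    ; bypass    = bypass′
    ; past      = past′
    }
    where
    sw : Swapped (run t) (run (suc t)) x y
    sw = Move⇒Swapped (next t) mv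
    x<y : u x Fin.< u y
    x<y = ⊲⇒u< (adjacent mv)
    x≢y : x ≢ y
    x≢y = u<⇒≢ x<y
    c≤y : u c Fin.≤ u y
    c≤y = ℕ.≤-trans (beyond sl) (ℕ.<⇒≤ x<y)
    beyond-y : ∀ {v} → y ⊲ v → run (suc t) at v ≡ run t at v
    beyond-y y⊲v = other sw (u<⇒≢ (ℕ.<-trans x<y (⊲⇒u< y⊲v)) ∘ sym) (u<⇒≢ (⊲⇒u< y⊲v) ∘ sym)
    y-sorted : ∀ {v} → y ⊲ v → run t at y Fin.< run (suc t) at v
    y-sorted {v} y⊲v =
      subst (run t at y Fin.<_) (sym (beyond-y y⊲v)) (sorted sl c≤y (x≢y ∘ sym) y⊲v)

    sorted′ : ∀ {w v} → u c Fin.≤ u w → w ≢ y → w ⊲ v →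
      run (suc t) at w Fin.< run (suc t) at v
    sorted′ {w} {v} c≤w w≢y w⊲v with w ≟ᶜ x | v ≟ᶜ x | v ≟ᶜ y
    ... | yes refl | yes refl | _        = contradiction w⊲v (⊲-irrefl {x = x})
    ... | yes refl | no _     | yes refl =
      subst₂ Fin._<_ (sym (at-x sw)) (sym (at-y sw)) (descent mv)
    ... | yes refl | no v≢x   | no v≢y   =
      subst₂ Fin._<_ (sym (at-x sw)) (sym (other sw v≢x v≢y))
        (≤∧≢⇒at< (run t) (v≢y ∘ sym) (minimal mv w⊲v))
    ... | no w≢x   | yes refl | _        =
      subst₂ Fin._<_ (sym (other sw w≢x w≢y)) (sym (at-x sw)) (bypass sl c≤w w⊲v (adjacent mv))
    ... | no w≢x   | no _     | yes refl =
      subst₂ Fin._<_ (sym (other sw w≢x w≢y)) (sym (at-y sw))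
        (ℕ.<-trans (sorted sl c≤w w≢x w⊲v) (descent mv))
    ... | no w≢x   | no v≢x   | no v≢y   =
      subst₂ Fin._<_ (sym (other sw w≢x w≢y)) (sym (other sw v≢x v≢y)) (sorted sl c≤w w≢x w⊲v)

    bypass′ : ∀ {w v} → u c Fin.≤ u w → w ⊲ y → y ⊲ v →
      run (suc t) at w Fin.< run (suc t) at v
    bypass′ {w} {v} c≤w w⊲y y⊲v with w ≟ᶜ x
    ... | yes refl = subst (Fin._< run (suc t) at v) (sym (at-x sw)) (y-sorted y⊲v)
    ... | no w≢x   = subst (Fin._< run (suc t) at v)
      (sym (other sw w≢x (u<⇒≢ (⊲⇒u< w⊲y))))
      (ℕ.<-trans (sorted sl c≤w w≢x w⊲y) (y-sorted y⊲v))

    past′ : ∀ {s x′ y′} → s < suc t → Move U (run s) x′ y′ → Past (suc t) c y s x′ y′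
    past′ s<1+t mv′ with ℕ.m≤n⇒m<n∨m≡n (ℕ.≤-pred s<1+t)
    ... | inj₂ refl with Move-unique mv mv′
    ...   | refl , refl = same-slide (origin sl) (beyond sl) (untouched sl) y-sorted
    past′ s<1+t mv′ | inj₁ s<t with past sl s<t mv′
    ... | same-slide e c≤x′ un less =
      same-slide e c≤x′ un λ y⊲v → ℕ.<-trans (less (adjacent mv)) (y-sorted y⊲v)
    ... | earlier-slide before = earlier-slide before

  slide-rest : ∀ {t c x} → Slide t c x → Standard (run t) → Slide (suc t) c x
  slide-rest {t} {c} {x} sl std = record
    { origin    = trans (e x) (origin sl)
    ; beyond    = beyond sl
    ; untouched = λ w<c → trans (e _) (untouched sl w<c)
    ; sorted    = λ c≤w w≢x w⊲v →
        subst₂ Fin._<_ (sym (e _)) (sym (e _)) (sorted sl c≤w w≢x w⊲v)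
    ; bypass    = λ c≤w w⊲x x⊲v →
        subst₂ Fin._<_ (sym (e _)) (sym (e _)) (bypass sl c≤w w⊲x x⊲v)
    ; past      = past′
    }
    where
    e : ∀ w → run (suc t) at w ≡ run t at w
    e = Standard⇒rest (next t) std
    past′ : ∀ {s x′ y′} → s < suc t → Move U (run s) x′ y′ → Past (suc t) c x s x′ y′
    past′ {s} {y′ = y′} s<1+t mv′ with ℕ.m≤n⇒m<n∨m≡n (ℕ.≤-pred s<1+t)
    ... | inj₂ refl = contradiction std (Move⇒¬Standard {T = run t} mv′)
    ... | inj₁ s<t with past sl s<t mv′
    ...   | same-slide e′ c≤x′ un less =
      same-slide e′ c≤x′ un λ x⊲v → subst (run s at y′ Fin.<_) (sym (e _)) (less x⊲v)
    ...   | earlier-slide before = earlier-slide before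

  -- If the next exchange does not continue the slide, then a new slide begins.
  slide-focus : ∀ {t c x x₁ y₁} → Slide t c x → Move U (run t) x₁ y₁ → ∃[ c₁ ] Slide t c₁ x₁
  slide-focus {t} {c} {x} {x₁} {y₁} sl mv with x₁ ≟ᶜ x
  ... | yes refl = c , sl
  ... | no x₁≢x  = x₁ , record
    { origin    = untouched sl x₁<c
    ; beyond    = ℕ.≤-refl
    ; untouched = λ w<x₁ → untouched sl (ℕ.<-trans w<x₁ x₁<c)
    ; sorted    = λ x₁≤w w≢x₁ → maximal mv (≤∧≢⇒at< (tableau U) (w≢x₁ ∘ sym) x₁≤w)
    ; bypass    = λ x₁≤w w⊲x₁ → contradiction x₁≤w (ℕ.<⇒≱ (⊲⇒u< w⊲x₁))
    ; past      = λ s<t mv′ → earlier-slide (earlier (past sl s<t mv′))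
    }
    where
    -- The cells from c on, other than x, are sorted.
    x₁<c : u x₁ Fin.< u c
    x₁<c = ℕ.≰⇒> λ c≤x₁ → ℕ.<-asym (descent mv) (sorted sl c≤x₁ x₁≢x (adjacent mv))
    earlier : ∀ {s x′ y′} → Past t c x s x′ y′ → ∀ {w} → u w Fin.≤ u x₁ →
      u w Fin.< u x′ × run s at w ≡ run 0 at w
    earlier (same-slide _ c≤x′ un _) w≤x₁ =
      ℕ.<-≤-trans w<c c≤x′ , un w<c
      where w<c = ℕ.≤-<-trans w≤x₁ x₁<c
    earlier (earlier-slide before) w≤x₁ = before (ℕ.<⇒≤ (ℕ.≤-<-trans w≤x₁ x₁<c))

  private
    greatest : {k : ℕ} → Fin k → Σ[ i ∈ Fin k ] (∀ (j : Fin k) → j Fin.≤ i)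
    greatest {suc k} _ = Fin.fromℕ k , Fin.≤fromℕ

  -- The cell in the argument only ensures that the diagram is not empty.
  slide : Cell Λ → ∀ t → ∃[ c ] ∃[ x ] Slide t c x
  slide x₀ zero with greatest (u x₀)
  ... | i , ≤i = _ , _ , slide-start λ w →
    subst (u w Fin.≤_) (sym (Inverse.strictlyInverseˡ (tableau U) i)) (≤i (u w))
  slide x₀ (suc t) with slide x₀ t | next t
  ... | c , x , sl | rest std _ = c , x , slide-rest sl std
  ... | c , x , sl | move mv _  with slide-focus sl mv
  ...   | c₁ , sl₁ = c₁ , _ , slide-step sl₁ mv

  -- If an entry falls from x to y at time t, then in every earlier exchange it
  -- was either the greater of the two entries, and the other one was less than
  -- the entry which it passes at time t, or it waited in a cell before x′ in
  -- the order of U.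
  before : ∀ {s t x y x′ y′} → s < t → Move U (run s) x′ y′ → Move U (run t) x y →
    (run s at x′ ≡ run t at x × run s at y′ Fin.< run t at y) ⊎
    (∃[ c ] (run s at c ≡ run t at x × u c Fin.< u x′))
  before {t = t} {x} s<t mv′ mv with slide x t
  ... | _ , _ , sl₀ with slide-focus sl₀ mv
  ...   | c , sl with past sl s<t mv′
  ...     | same-slide e _ _ less  = inj₁ (trans e (sym (origin sl)) , less (adjacent mv))
  ...     | earlier-slide earlier with earlier {c} ℕ.≤-refl
  ...       | c<x′ , e = inj₂ (c , trans e (sym (origin sl)) , c<x′)

module _ {n : ℕ} {Λ : Partition n} {U : SYT Λ} (R : Run U) where

  open Run R

  -- At the later time, b would have to pass an entry greater than a.
  exchanged-once : {a b : Fin n} {x y : Cell Λ} → a Fin.< b → ∀ {s t} → s < t →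
    Exchanged (run s) (run (suc s)) a b x y → ¬ Exchanged (run t) (run (suc t)) a b x y
  exchanged-once {a} {b} {x} {y} a<b {s} {t} s<t ex@((sx , sy) , _) ex′@((tx , ty) , _)
    with Slides.before R s<t (Exchanged⇒Move {T = run s} {run (suc s)} (next s) a<b ex)
                             (Exchanged⇒Move {T = run t} {run (suc t)} (next t) a<b ex′)
  ... | inj₁ (_ , lt) = ℕ.<-irrefl (cong toℕ (trans sx (sym tx))) lt
  ... | inj₂ (c , e , c<y) = ℕ.<-irrefl (cong (λ z → toℕ (tableau U at z))
    (at-injective (run s) (trans e (trans ty (sym sy))))) c<y

-- Replacing the greater entry of an exchange

-- A relabelling of the entries that replaces b by b′ and preserves the order
-- of the other entries.
record Replaces {n : ℕ} (b b′ : Fin n) (σ : Permutation′ n) : Set where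
  field
    replaces : σ ⟨$⟩ʳ b ≡ b′
    monotone : ∀ {i j} → i ≢ b → j ≢ b → i Fin.< j → (σ ⟨$⟩ʳ i) Fin.< (σ ⟨$⟩ʳ j)

  monotone-≤ : ∀ {i j} → i ≢ b → j ≢ b → i Fin.≤ j → (σ ⟨$⟩ʳ i) Fin.≤ (σ ⟨$⟩ʳ j)
  monotone-≤ {i} {j} i≢b j≢b i≤j with i Fin.≟ j
  ... | yes refl = ℕ.≤-refl
  ... | no  i≢j  = ℕ.<⇒≤ (monotone i≢b j≢b (Fin.≤∧≢⇒< i≤j i≢j))

module _ {n : ℕ} {Λ : Partition n} {U : SYT Λ}
         {b b′ : Fin n} {σ : Permutation′ n} (σ-replaces : Replaces b b′ σ) where

  open Replaces σ-replaces

  -- If b is in no cell after x, then the comparisons which determine the step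
  -- from T do not involve b, except for the one between x and y.
  Move-relabel : {S T : Tableau Λ} {x y : Cell Λ} → S ≈[ σ ] T → Move U T x y →
    (∀ {w} → tableau U at x Fin.< tableau U at w → T at w ≢ b) →
    (σ ⟨$⟩ʳ (T at y)) Fin.< (σ ⟨$⟩ʳ (T at x)) → Move U S x y
  Move-relabel {S} {T} {x} {y} eq mv no-b desc = record
    { adjacent = adjacent mv
    ; descent  = subst₂ Fin._<_ (sym (eq y)) (sym (eq x)) desc
    ; minimal  = λ {w} x⊲w → subst₂ Fin._≤_ (sym (eq y)) (sym (eq w))
        (monotone-≤ (no-b (⊲⇒< U (adjacent mv))) (no-b (⊲⇒< U x⊲w)) (minimal mv x⊲w))
    ; maximal  = λ {w} {v} x<w w⊲v → subst₂ Fin._<_ (sym (eq w)) (sym (eq v))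
        (monotone (no-b x<w) (no-b (ℕ.<-trans x<w (⊲⇒< U w⊲v))) (maximal mv x<w w⊲v))
    }

  -- Up to the time when b is exchanged with a, the runs from T and from σ ∘ T
  -- agree up to σ: b waits, or passes entries which are at most a, and these
  -- are less than both b and b′.
  module Parallel (R R′ : Run U) {a : Fin n} (a<b : a Fin.< b) (a<b′ : a Fin.< b′)
                  (fixed : σ ⟨$⟩ʳ a ≡ a)
                  (start : Run.run R′ 0 ≈[ σ ] Run.run R 0) where

    open Run R
    open Run R′ renaming (run to run′; next to next′)

    private
      u : Cell Λ → Fin n
      u x = tableau U at x

    relabelled : ∀ {s p q} → run′ s ≈[ σ ] run s → Move U (run s) p q →
      (run s at p ≡ b × run s at q Fin.≤ a) ⊎ (∃[ c ] (run s at c ≡ b × u c Fin.< u p)) →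
      Move U (run′ s) p q
    relabelled {s} {p} {q} eq mv (inj₁ (p≡b , q≤a)) =
      Move-relabel {S = run′ s} {T = run s} eq mv no-b
        (subst ((σ ⟨$⟩ʳ (run s at q)) Fin.<_) (sym (trans (cong (σ ⟨$⟩ʳ_) p≡b) replaces))
          (ℕ.≤-<-trans
            (subst ((σ ⟨$⟩ʳ (run s at q)) Fin.≤_) fixed
              (monotone-≤ (no-b (⊲⇒< U (adjacent mv))) (Fin.<⇒≢ a<b) q≤a))
            a<b′))
      where
      no-b : ∀ {w} → u p Fin.< u w → run s at w ≢ b
      no-b p<w w≡b = ℕ.<-irrefl (cong (toℕ ∘ u) (at-injective (run s) (trans p≡b (sym w≡b)))) p<w
    relabelled {s} {p} {q} eq mv (inj₂ (c , c≡b , c<p)) =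
      Move-relabel {S = run′ s} {T = run s} eq mv (λ p<w → no-b (ℕ.<⇒≤ p<w))
        (monotone (no-b (ℕ.<⇒≤ (⊲⇒< U (adjacent mv)))) (no-b ℕ.≤-refl) (descent mv))
      where
      no-b : ∀ {w} → u p Fin.≤ u w → run s at w ≢ b
      no-b p≤w w≡b = ℕ.<⇒≱ c<p
        (subst (λ z → u p Fin.≤ u z) (at-injective (run s) (trans w≡b (sym c≡b))) p≤w)

    module _ {t : ℕ} {x y : Cell Λ} (mv : Move U (run t) y x)
             (at-b : run t at y ≡ b) (at-a : run t at x ≡ a) where

      parallel : ∀ s → s ≤ t → run′ s ≈[ σ ] run s
      parallel zero    _   = start
      parallel (suc s) s<t with next s | parallel s (ℕ.<⇒≤ s<t)
      ... | rest std _ | _  = contradiction s<t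
        (ℕ.<-asym (¬Standard⇒< R {t} {s} std (Move⇒¬Standard {T = run t} mv)))
      ... | move mv′ sw | eq = Swapped-relabel {U = U}
        {run′ s} {run′ (suc s)} {run s} {run (suc s)} {σ = σ} sw
        (Move⇒Swapped (next′ s) (relabelled {s} eq mv′ (waits (Slides.before R s<t mv′ mv)))) eq
        where
        waits : ∀ {p q} →
          (run s at p ≡ run t at y × run s at q Fin.< run t at x) ⊎
            (∃[ c ] (run s at c ≡ run t at y × u c Fin.< u p)) →
          (run s at p ≡ b × run s at q Fin.≤ a) ⊎ (∃[ c ] (run s at c ≡ b × u c Fin.< u p))
        waits (inj₁ (e , lt))     =
          inj₁ (trans e at-b , ℕ.<⇒≤ (subst (_ Fin.<_) at-a lt))
        waits (inj₂ (c , e , lt)) = inj₂ (c , trans e at-b , lt)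

      exchanged-in-parallel : Exchanged (run′ t) (run′ (suc t)) a b′ x y
      exchanged-in-parallel = Swapped⇒Exchanged {U = U} {run′ t} {run′ (suc t)}
        (Move⇒Swapped (next′ t)
          (relabelled {t} eq mv (inj₁ (at-b , ℕ.≤-reflexive (cong toℕ at-a)))))
        (trans (eq x) (trans (cong (σ ⟨$⟩ʳ_) at-a) fixed))
        (trans (eq y) (trans (cong (σ ⟨$⟩ʳ_) at-b) replaces))
        where eq = parallel t ℕ.≤-refl

-- Moves b to b′, and keeps the order of the other entries.
replacement : {k : ℕ} (b b′ : Fin (suc k)) → Permutation′ (suc k)
replacement b b′ = insert b b′ id

replacement-replaces : {k : ℕ} (b b′ : Fin (suc k)) → Replaces b b′ (replacement b b′)
replacement-replaces {k} b b′ = record { replaces = replaces ; monotone = monotone }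
  where
  replaces : insert b b′ id ⟨$⟩ʳ b ≡ b′
  replaces with b Fin.≟ b
  ... | yes _  = refl
  ... | no b≢b = contradiction refl b≢b
  value : ∀ {i} (b≢i : b ≢ i) → insert b b′ id ⟨$⟩ʳ i ≡ punchIn b′ (punchOut b≢i)
  value {i} b≢i = trans (cong (insert b b′ id ⟨$⟩ʳ_) (sym (Fin.punchIn-punchOut b≢i)))
    (Perm.insert-punchIn b b′ id (punchOut b≢i))
  monotone : ∀ {i j} → i ≢ b → j ≢ b → i Fin.< j →
    (insert b b′ id ⟨$⟩ʳ i) Fin.< (insert b b′ id ⟨$⟩ʳ j)
  monotone {i} {j} i≢b j≢b i<j = subst₂ Fin._<_ (sym (value (i≢b ∘ sym))) (sym (value (j≢b ∘ sym)))
    (Fin.≤∧≢⇒< (Fin.punchIn-mono-≤ b′ _ _ (Fin.punchOut-mono-≤ (i≢b ∘ sym) (j≢b ∘ sym) (ℕ.<⇒≤ i<j)))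
      (λ e → Fin.<⇒≢ i<j (Fin.punchOut-injective (i≢b ∘ sym) (j≢b ∘ sym)
        (Fin.punchIn-injective b′ _ _ e))))

-- Insertion and deletion at i do not affect the numbers less than i.
punchIn-< : {k : ℕ} (i : Fin (suc k)) (j : Fin k) → toℕ j < toℕ i → toℕ (punchIn i j) ≡ toℕ j
punchIn-< (suc i) zero    _         = refl
punchIn-< (suc i) (suc j) (s≤s j<i) = cong suc (punchIn-< i j j<i)

punchOut-< : {k : ℕ} {i j : Fin (suc k)} (i≢j : i ≢ j) → j Fin.< i → toℕ (punchOut i≢j) ≡ toℕ j
punchOut-< {suc k} {suc i} {zero}  _   _         = refl
punchOut-< {suc k} {suc i} {suc j} i≢j (s≤s j<i) = cong suc (punchOut-< (i≢j ∘ cong suc) j<i)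

replacement-fixes : {k : ℕ} {a : Fin (suc k)} (b b′ : Fin (suc k)) → a Fin.< b → a Fin.< b′ →
  replacement b b′ ⟨$⟩ʳ a ≡ a
replacement-fixes {a = a} b b′ a<b a<b′ = trans
  (cong (insert b b′ id ⟨$⟩ʳ_) (sym (Fin.punchIn-punchOut b≢a)))
  (trans (Perm.insert-punchIn b b′ id (punchOut b≢a))
    (Fin.toℕ-injective (trans (punchIn-< b′ _ (subst (_< toℕ b′) (sym out) a<b′)) out)))
  where
  b≢a : b ≢ a
  b≢a e = ℕ.<-irrefl (cong toℕ (sym e)) a<b
  out : toℕ (punchOut b≢a) ≡ toℕ a
  out = punchOut-< b≢a a<b

replacement-inverse : {k : ℕ} (b b′ i : Fin (suc k)) →
  replacement b′ b ⟨$⟩ʳ (replacement b b′ ⟨$⟩ʳ i) ≡ i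
replacement-inverse b b′ i = cases (b Fin.≟ i)
  where
  cases : Dec (b ≡ i) → replacement b′ b ⟨$⟩ʳ (replacement b b′ ⟨$⟩ʳ i) ≡ i
  cases (yes refl) = trans
    (cong (replacement b′ b ⟨$⟩ʳ_) (Replaces.replaces (replacement-replaces b b′)))
    (Replaces.replaces (replacement-replaces b′ b))
  cases (no b≢i)   = subst (λ j → replacement b′ b ⟨$⟩ʳ (replacement b b′ ⟨$⟩ʳ j) ≡ j)
    (Fin.punchIn-punchOut b≢i)
    (trans (cong (replacement b′ b ⟨$⟩ʳ_) (Perm.insert-punchIn b b′ id (punchOut b≢i)))
      (Perm.insert-punchIn b′ b id (punchOut b≢i)))

-- Falls and rises of an entry

-- The entries less than b, and those greater than b.
below above : {n : ℕ} → Fin n → List (Fin n)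
below {n} b = filter (Fin._<? b) (allFin n)
above {n} b = filter (b Fin.<?_) (allFin n)

∈-below⁻ : {n : ℕ} {a b : Fin n} → a ∈ below b → a Fin.< b
∈-below⁻ {n} {b = b} a∈ = proj₂ (∈-filter⁻ (Fin._<? b) {xs = allFin n} a∈)

∈-above⁻ : {n : ℕ} {b c : Fin n} → c ∈ above b → b Fin.< c
∈-above⁻ {n} {b} c∈ = proj₂ (∈-filter⁻ (b Fin.<?_) {xs = allFin n} c∈)

∈-below⁺ : {n : ℕ} {a b : Fin n} → a Fin.< b → a ∈ below b
∈-below⁺ {a = a} {b} = ∈-filter⁺ (Fin._<? b) (∈-allFin a)

∈-above⁺ : {n : ℕ} {b c : Fin n} → b Fin.< c → c ∈ above b
∈-above⁺ {b = b} {c} = ∈-filter⁺ (b Fin.<?_) (∈-allFin c)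

below-unique : {n : ℕ} (b : Fin n) → Unique (below b)
below-unique {n} b = Unique.filter⁺ (Fin._<? b) (Unique.allFin⁺ n)

above-unique : {n : ℕ} (b : Fin n) → Unique (above b)
above-unique {n} b = Unique.filter⁺ (b Fin.<?_) (Unique.allFin⁺ n)

module _ {n : ℕ} {Λ : Partition n} where

  cells-unique : Unique (cells Λ)
  cells-unique = Unique.map⁺ (λ {i} {j} e →
    trans (sym (Inverse.strictlyInverseˡ (reading Λ) i))
      (trans (cong (reading Λ at_) e) (Inverse.strictlyInverseˡ (reading Λ) j)))
    (Unique.allFin⁺ n)

  N⁺-unique : (x : Cell Λ) → Unique (N⁺ x)
  N⁺-unique x = Unique.filter⁺ (x ⊲?_) cells-unique

  N⁻-unique : (x : Cell Λ) → Unique (N⁻ x)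
  N⁻-unique x = Unique.filter⁺ (_⊲? x) cells-unique

  ∈-N⁺ : {x y : Cell Λ} → x ⊲ y → y ∈ N⁺ x
  ∈-N⁺ {x} {y} = ∈-filter⁺ (x ⊲?_) (∈-cells y)

  ∈-N⁻ : {x y : Cell Λ} → y ⊲ x → y ∈ N⁻ x
  ∈-N⁻ {x} {y} = ∈-filter⁺ (_⊲? x) (∈-cells y)

module _ {n : ℕ} {Λ : Partition n} where

  -- The numbers of exchanges between T and T′ by which the entry b enters x
  -- or leaves x, b being the greater (fall) or the smaller (rise) of the two
  -- exchanged entries.
  fall-in fall-out rise-in rise-out : (T T′ : Tableau Λ) → Fin n → Cell Λ → ℕ
  fall-in  T T′ b x = ∑ (below b) λ a → ∑ (N⁻ x) λ y → [ exchanged? T T′ a b x y ]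
  fall-out T T′ b x = ∑ (below b) λ a → ∑ (N⁺ x) λ y → [ exchanged? T T′ a b y x ]
  rise-in  T T′ b x = ∑ (above b) λ c → ∑ (N⁺ x) λ y → [ exchanged? T T′ b c y x ]
  rise-out T T′ b x = ∑ (above b) λ c → ∑ (N⁻ x) λ y → [ exchanged? T T′ b c x y ]

  -- What a step does to the entry b: it stays, falls from p to q, or rises
  -- from q to p.
  data Motion (U : SYT Λ) (b : Fin n) (T T′ : Tableau Λ) : Set where
    stays : (∀ {w} → T at w ≡ b → T′ at w ≡ b) → (∀ {w} → T′ at w ≡ b → T at w ≡ b) →
      (∀ x → fall-in T T′ b x ≡ 0) → (∀ x → fall-out T T′ b x ≡ 0) →
      (∀ x → rise-in T T′ b x ≡ 0) → (∀ x → rise-out T T′ b x ≡ 0) → Motion U b T T′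
    falls : ∀ {p q} → Move U T p q → T at p ≡ b → T′ at q ≡ b →
      (∀ x → fall-in T T′ b x ≡ [ q ≟ᶜ x ]) → (∀ x → fall-out T T′ b x ≡ [ p ≟ᶜ x ]) →
      (∀ x → rise-in T T′ b x ≡ 0) → (∀ x → rise-out T T′ b x ≡ 0) → Motion U b T T′
    rises : ∀ {p q} → Move U T p q → T at q ≡ b → T′ at p ≡ b →
      (∀ x → fall-in T T′ b x ≡ 0) → (∀ x → fall-out T T′ b x ≡ 0) →
      (∀ x → rise-in T T′ b x ≡ [ p ≟ᶜ x ]) → (∀ x → rise-out T T′ b x ≡ [ q ≟ᶜ x ]) →
      Motion U b T T′

  module _ {U : SYT Λ} {T T′ : Tableau Λ} where

    no-∑∑ : {as : List (Fin n)} (ys : List (Cell Λ)) {P : Fin n → Cell Λ → Set}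
      (P? : ∀ a y → Dec (P a y)) → (∀ {a y} → a ∈ as → ¬ P a y) →
      ∑ as (λ a → ∑ ys λ y → [ P? a y ]) ≡ 0
    no-∑∑ {as} ys P? no-P = ∑-0 as λ a∈ → ∑-0 ys λ _ → []-no (P? _ _) (no-P a∈)

    no-falls : {b : Fin n} → Next U T T′ → (∀ {p q} → Move U T p q → T at p ≢ b) →
      (∀ x → fall-in T T′ b x ≡ 0) × (∀ x → fall-out T T′ b x ≡ 0)
    no-falls {b} nx never =
      (λ x → no-∑∑ (N⁻ x) (λ a y → exchanged? T T′ a b x y) λ a∈ ex →
        never (Exchanged⇒Move {U = U} {T} {T′} nx (∈-below⁻ a∈) ex) (proj₂ (proj₁ ex))) ,
      (λ x → no-∑∑ (N⁺ x) (λ a y → exchanged? T T′ a b y x) λ a∈ ex →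
        never (Exchanged⇒Move {U = U} {T} {T′} nx (∈-below⁻ a∈) ex) (proj₂ (proj₁ ex)))

    no-rises : {b : Fin n} → Next U T T′ → (∀ {p q} → Move U T p q → T at q ≢ b) →
      (∀ x → rise-in T T′ b x ≡ 0) × (∀ x → rise-out T T′ b x ≡ 0)
    no-rises {b} nx never =
      (λ x → no-∑∑ (N⁺ x) (λ c y → exchanged? T T′ b c y x) λ c∈ ex →
        never (Exchanged⇒Move {U = U} {T} {T′} nx (∈-above⁻ c∈) ex) (proj₁ (proj₁ ex))) ,
      (λ x → no-∑∑ (N⁻ x) (λ c y → exchanged? T T′ b c x y) λ c∈ ex →
        never (Exchanged⇒Move {U = U} {T} {T′} nx (∈-above⁻ c∈) ex) (proj₁ (proj₁ ex)))

    motion-move : (b : Fin n) {p q : Cell Λ} → Move U T p q → Swapped T T′ p q →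
      Motion U b T T′
    motion-move b {p} {q} mv sw with T at p Fin.≟ b | T at q Fin.≟ b
    ... | yes refl | _ =
      falls mv refl (at-y sw)
        (λ x → ∑∑-indicator (λ a y → exchanged? T T′ a b x y) (q ≟ᶜ x) {T at q} {p}
          (below-unique b) (N⁻-unique x)
          (λ a∈ y∈ ex → let p≡y , q≡x = same a∈ ex in
            q≡x , trans (sym (proj₁ (proj₁ ex))) (cong (T at_) (sym q≡x)) , sym p≡y)
          (λ { refl → ∈-below⁺ (descent mv) , ∈-N⁻ (adjacent mv) ,
                      Swapped⇒Exchanged {U = U} {T} {T′} sw refl refl }))
        (λ x → ∑∑-indicator (λ a y → exchanged? T T′ a b y x) (p ≟ᶜ x) {T at q} {q}
          (below-unique b) (N⁺-unique x)
          (λ a∈ y∈ ex → let p≡x , q≡y = same a∈ ex in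
            p≡x , trans (sym (proj₁ (proj₁ ex))) (cong (T at_) (sym q≡y)) , sym q≡y)
          (λ { refl → ∈-below⁺ (descent mv) , ∈-N⁺ (adjacent mv) ,
                      Swapped⇒Exchanged {U = U} {T} {T′} sw refl refl }))
        (proj₁ none) (proj₂ none)
      where
      same : {a : Fin n} {x y : Cell Λ} → a ∈ below b → Exchanged T T′ a b x y → p ≡ y × q ≡ x
      same a∈ ex = Move-unique {U = U} {T} mv
        (Exchanged⇒Move {U = U} {T} {T′} (move mv sw) (∈-below⁻ a∈) ex)
      none = no-rises (move mv sw) λ mv′ e → ℕ.<-irrefl
        (cong toℕ (trans (cong (T at_) (proj₂ (Move-unique {U = U} {T} mv mv′))) e)) (descent mv)
    ... | no p≢b | yes refl =
      rises mv refl (at-x sw) (proj₁ none) (proj₂ none)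
        (λ x → ∑∑-indicator (λ c y → exchanged? T T′ b c y x) (p ≟ᶜ x) {T at p} {q}
          (above-unique b) (N⁺-unique x)
          (λ c∈ y∈ ex → let p≡x , q≡y = same c∈ ex in
            p≡x , trans (sym (proj₂ (proj₁ ex))) (cong (T at_) (sym p≡x)) , sym q≡y)
          (λ { refl → ∈-above⁺ (descent mv) , ∈-N⁺ (adjacent mv) ,
                      Swapped⇒Exchanged {U = U} {T} {T′} sw refl refl }))
        (λ x → ∑∑-indicator (λ c y → exchanged? T T′ b c x y) (q ≟ᶜ x) {T at p} {p}
          (above-unique b) (N⁻-unique x)
          (λ c∈ y∈ ex → let p≡y , q≡x = same c∈ ex in
            q≡x , trans (sym (proj₂ (proj₁ ex))) (cong (T at_) (sym p≡y)) , sym p≡y)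
          (λ { refl → ∈-above⁺ (descent mv) , ∈-N⁻ (adjacent mv) ,
                      Swapped⇒Exchanged {U = U} {T} {T′} sw refl refl }))
      where
      same : {c : Fin n} {x y : Cell Λ} → c ∈ above b → Exchanged T T′ b c x y → p ≡ y × q ≡ x
      same c∈ ex = Move-unique {U = U} {T} mv
        (Exchanged⇒Move {U = U} {T} {T′} (move mv sw) (∈-above⁻ c∈) ex)
      none = no-falls (move mv sw) λ mv′ e →
        p≢b (trans (cong (T at_) (proj₁ (Move-unique {U = U} {T} mv mv′))) e)
    ... | no p≢b | no q≢b =
      stays (λ Tw → trans (other sw (≢ Tw p≢b) (≢ Tw q≢b)) Tw) unmoved
        (proj₁ none) (proj₂ none) (proj₁ none′) (proj₂ none′)
      where
      ≢ : {w v : Cell Λ} → T at w ≡ b → T at v ≢ b → w ≢ v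
      ≢ Tw v≢b refl = v≢b Tw
      unmoved : {w : Cell Λ} → T′ at w ≡ b → T at w ≡ b
      unmoved {w} T′w with w ≟ᶜ p | w ≟ᶜ q
      ... | yes refl | _        = contradiction (trans (sym (at-x sw)) T′w) q≢b
      ... | no _     | yes refl = contradiction (trans (sym (at-y sw)) T′w) p≢b
      ... | no w≢p   | no w≢q   = trans (sym (other sw w≢p w≢q)) T′w
      none = no-falls (move mv sw) λ mv′ e →
        p≢b (trans (cong (T at_) (proj₁ (Move-unique {U = U} {T} mv mv′))) e)
      none′ = no-rises (move mv sw) λ mv′ e →
        q≢b (trans (cong (T at_) (proj₂ (Move-unique {U = U} {T} mv mv′))) e)

    motion : (b : Fin n) → Next U T T′ → Motion U b T T′
    motion b (move mv sw)         = motion-move b mv sw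
    motion b nx@(rest std e) =
      stays (λ Tw → trans (e _) Tw) (λ T′w → trans (sym (e _)) T′w)
        (proj₁ none) (proj₂ none) (proj₁ none′) (proj₂ none′)
      where
      none = no-falls {b} nx λ mv → contradiction std (Move⇒¬Standard {U = U} {T = T} mv)
      none′ = no-rises {b} nx λ mv → contradiction std (Move⇒¬Standard {U = U} {T = T} mv)

-- Drop cells

-- The entry b first falls, while it slides from its initial cell to its drop
-- cell, and then only rises.
module Drop {n : ℕ} {Λ : Partition n} {U : SYT Λ} (R : Run U) (b : Fin n) where

  open Run R

  private
    ∑ₜ : ℕ → ((T T′ : Tableau Λ) → Fin n → Cell Λ → ℕ) → Cell Λ → ℕ
    ∑ₜ t f x = ∑< t λ s → f (run s) (run (suc s)) b x

  -- By the falls of b before time t it has come from its initial cell to q, the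
  -- highest cell so far, and by its rises before time t from q to its present
  -- cell.  If it has not risen yet, then it is still at q.
  record DropCell (t : ℕ) (q : Cell Λ) : Set where
    field
      reached : ∃[ i ] (i < suc t × run i at q ≡ b)
      highest : ∀ {i x} → i < suc t → run i at x ≡ b → x ≡ q ⊎ height x < height q
      current : run t at q ≡ b ⊎
        (∃[ s ] ∃[ x ] ∃[ y ] (s < t × Move U (run s) x y × run s at y ≡ b))
      fallen  : ∀ x → Balance [ q ≟ᶜ x ] (∑ₜ t fall-out x) [ run 0 at x Fin.≟ b ] (∑ₜ t fall-in x)
      risen   : ∀ x → Balance [ run t at x Fin.≟ b ] (∑ₜ t rise-out x) [ q ≟ᶜ x ] (∑ₜ t rise-in x)

  open DropCell

  private
    at-unique : ∀ {t x y} → run t at x ≡ b → run t at y ≡ b → x ≡ y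
    at-unique {t} ex ey = at-injective (run t) (trans ex (sym ey))

    [at]≡[≟ᶜ] : ∀ {t p} → run t at p ≡ b → ∀ x → [ run t at x Fin.≟ b ] ≡ [ p ≟ᶜ x ]
    [at]≡[≟ᶜ] {t} {p} e x = []-cong (run t at x Fin.≟ b) (p ≟ᶜ x)
      (at-unique {t} e) (λ { refl → e })

    up-to : ∀ {t} {P : ℕ → Set} → (∀ {i} → i < suc t → P i) → P (suc t) →
      ∀ {i} → i < suc (suc t) → P i
    up-to {P = P} below-t at-t i<2+t with ℕ.m≤n⇒m<n∨m≡n (ℕ.≤-pred i<2+t)
    ... | inj₁ i<1+t = below-t i<1+t
    ... | inj₂ refl  = at-t

    -- An entry that falls has not risen before.
    earlier : ∀ {t x y} → Move U (run t) x y → run t at x ≡ b →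
      ¬ (∃[ s ] ∃[ x ] ∃[ y ] (s < t × Move U (run s) x y × run s at y ≡ b))
    earlier mv x≡b (s , x′ , y′ , s<t , mv′ , y′≡b) with Slides.before R s<t mv′ mv
    ... | inj₁ (e , _) = ⊲-irrefl {x = x′}
      (subst (x′ ⊲_) (at-unique {s} y′≡b (trans e x≡b)) (adjacent mv′))
    ... | inj₂ (c , e , c<x′) = ℕ.<-asym c<x′
      (subst (λ z → tableau U at x′ Fin.< tableau U at z)
        (at-unique {s} y′≡b (trans e x≡b)) (⊲⇒< U (adjacent mv′)))

    start : DropCell 0 (cellOf (run 0) b)
    start = record
      { reached = 0 , ℕ.≤-refl , at₀
      ; highest = λ { {zero} _ e → inj₁ (at-unique {0} e at₀) ; {suc _} (s≤s ()) _ }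
      ; current = inj₁ at₀
      ; fallen  = λ x → balanced (cong (_+ 0) (sym ([at]≡[≟ᶜ] {0} at₀ x)))
      ; risen   = λ x → balanced (cong (_+ 0) ([at]≡[≟ᶜ] {0} at₀ x))
      }
      where
      at₀ : run 0 at cellOf (run 0) b ≡ b
      at₀ = Inverse.strictlyInverseˡ (run 0) b

    later : ∀ {t} → (∃[ s ] ∃[ x ] ∃[ y ] (s < t × Move U (run s) x y × run s at y ≡ b)) →
      ∃[ s ] ∃[ x ] ∃[ y ] (s < suc t × Move U (run s) x y × run s at y ≡ b)
    later (s , x , y , s<t , mv) = s , x , y , ℕ.m<n⇒m<1+n s<t , mv

    advance : ∀ {t q} → DropCell t q → Motion U b (run t) (run (suc t)) → ∃[ q′ ] DropCell (suc t) q′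
    advance {t} {q} dc (stays forth back fi fo ri ro) = q , record
      { reached = let i , i<1+t , e = reached dc in i , ℕ.m<n⇒m<1+n i<1+t , e
      ; highest = λ {i} {x} i<2+t → up-to {P = λ i → run i at x ≡ b → x ≡ q ⊎ height x < height q}
          (highest dc) (λ e → highest dc ℕ.≤-refl (back e)) i<2+t
      ; current = current′ (current dc)
      ; fallen  = λ x → balance-rest (fi x) (fo x) (fallen dc x)
      ; risen   = λ x → balance-rest (ri x) (ro x) (balance-now
          ([]-cong (run (suc t) at x Fin.≟ b) (run t at x Fin.≟ b) back forth) (risen dc x))
      }
      where
      current′ : _ → _
      current′ (inj₁ e) = inj₁ (forth e)
      current′ (inj₂ r) = inj₂ (later r)
    advance {t} {q} dc (falls {p} {q′} mv p≡b q′≡b fi fo ri ro) with current dc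
    ... | inj₂ r = contradiction r (earlier {t} mv p≡b)
    ... | inj₁ q≡b with at-unique {t} q≡b p≡b
    ...   | refl = q′ , record
      { reached = suc t , ℕ.≤-refl , q′≡b
      ; highest = λ {i} {x} i<2+t → up-to {P = λ i → run i at x ≡ b → x ≡ q′ ⊎ height x < height q′}
          (λ i<1+t e → inj₂ (lower (highest dc i<1+t e))) (λ e → inj₁ (at-unique {suc t} e q′≡b)) i<2+t
      ; current = inj₁ q′≡b
      ; fallen  = λ x → balance-move (fi x) (fo x) (fallen dc x)
      ; risen   = λ x → balance-rest (ri x) (ro x)
          (balance-shift ([at]≡[≟ᶜ] {t} p≡b x) ([at]≡[≟ᶜ] {suc t} q′≡b x) (risen dc x))
      }
      where
      lower : ∀ {x} → x ≡ q ⊎ height x < height q → height x < height q′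
      lower (inj₁ refl) = Move⇒height< mv
      lower (inj₂ lt)   = ℕ.<-trans lt (Move⇒height< mv)
    advance {t} {q} dc (rises {p} {q₁} mv q₁≡b p≡b fi fo ri ro) = q , record
      { reached = let i , i<1+t , e = reached dc in i , ℕ.m<n⇒m<1+n i<1+t , e
      ; highest = λ {i} {x} i<2+t → up-to {P = λ i → run i at x ≡ b → x ≡ q ⊎ height x < height q}
          (highest dc) (λ e → inj₂ (lower (at-unique {suc t} e p≡b) (highest dc ℕ.≤-refl q₁≡b))) i<2+t
      ; current = inj₂ (t , p , q₁ , ℕ.≤-refl , mv , q₁≡b)
      ; fallen  = λ x → balance-rest (fi x) (fo x) (fallen dc x)
      ; risen   = λ x → balance-move
          (trans (ri x) (sym ([at]≡[≟ᶜ] {suc t} p≡b x)))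
          (trans (ro x) (sym ([at]≡[≟ᶜ] {t} q₁≡b x))) (risen dc x)
      }
      where
      lower : ∀ {x} → x ≡ p → q₁ ≡ q ⊎ height q₁ < height q → height x < height q
      lower refl (inj₁ refl) = Move⇒height< mv
      lower refl (inj₂ lt)   = ℕ.<-trans (Move⇒height< mv) lt

  drop-cell : ∀ t → ∃[ q ] DropCell t q
  drop-cell zero    = _ , start
  drop-cell (suc t) = advance (proj₂ (drop-cell t)) (motion b (next t))

  module _ {t : ℕ} {q : Cell Λ} (drop : DropCell t q) where

    private
      heightᵇ : ℕ → ℕ
      heightᵇ i = height (cellOf (run i) b)

      at-cellOf : ∀ i → run i at cellOf (run i) b ≡ b
      at-cellOf i = Inverse.strictlyInverseˡ (run i) b

    max-height : max 0 (map heightᵇ (upTo (suc t))) ≡ height q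
    max-height = max≈v⁺
      (subst (_∈ map heightᵇ (upTo (suc t))) top (∈-map⁺ heightᵇ (∈-upTo⁺ i<1+t)))
      (All.tabulate λ h∈ → let i , i∈ , eq = ∈-map⁻ heightᵇ h∈ in
        subst (_≤ height q) (sym eq) (≤top (highest drop (∈-upTo⁻ i∈) (at-cellOf i))))
      z≤n
      where
      i₀ = proj₁ (reached drop)
      i<1+t = proj₁ (proj₂ (reached drop))
      top : heightᵇ i₀ ≡ height q
      top = cong height (at-unique {i₀} (at-cellOf i₀) (proj₂ (proj₂ (reached drop))))
      ≤top : {x : Cell Λ} → x ≡ q ⊎ height x < height q → height x ≤ height q
      ≤top (inj₁ refl) = ℕ.≤-refl
      ≤top (inj₂ lt)   = ℕ.<⇒≤ lt

    -- The cell x has the maximal height attained by b up to time t, and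
    -- contains b at some time up to t.
    Dropped : Cell Λ → Set
    Dropped x = height x ≡ max 0 (map heightᵇ (upTo (suc t))) ×
                ∃[ i ] (i < suc t × run i at x ≡ b)

    dropped⇒≡ : {x : Cell Λ} → Dropped x → q ≡ x
    dropped⇒≡ (hx , i , i<1+t , e) with highest drop i<1+t e
    ... | inj₁ x≡q = sym x≡q
    ... | inj₂ lt  = contradiction lt (ℕ.<-irrefl (trans hx max-height))

    ≡⇒dropped : {x : Cell Λ} → q ≡ x → Dropped x
    ≡⇒dropped refl = sym max-height , reached drop

-- Sums over all tableaux

-- Pointwise equality of permutations is decidable.
_≈ₚ?_ : {k : ℕ} (π ρ : Permutation′ k) → Dec (∀ i → π ⟨$⟩ʳ i ≡ ρ ⟨$⟩ʳ i)
π ≈ₚ? ρ = Fin.all? λ i → (π ⟨$⟩ʳ i) Fin.≟ (ρ ⟨$⟩ʳ i)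

-- Up to pointwise equality, insert zero j π is ρ iff j is the image of zero and
-- π is what remains of ρ.
permutations-once : {k : ℕ} (ρ : Permutation′ k) →
  ∑ (permutations k) (λ π → [ π ≈ₚ? ρ ]) ≡ 1
permutations-once {zero}  ρ = cong (_+ 0) ([]-yes (id ≈ₚ? ρ) λ ())
permutations-once {suc k} ρ = begin
  ∑ (permutations (suc k)) (λ π → [ π ≈ₚ? ρ ])
    ≡⟨ ∑-concatMap (λ j → map (insert zero j) (permutations k)) (allFin (suc k)) _ ⟩
  ∑ (allFin (suc k)) (λ j → ∑ (map (insert zero j) (permutations k)) λ π → [ π ≈ₚ? ρ ])
    ≡⟨ ∑-cong (allFin (suc k)) (λ j → ∑-map (insert zero j) (permutations k) _) ⟩
  ∑ (allFin (suc k)) (λ j → ∑ (permutations k) λ π → [ insert zero j π ≈ₚ? ρ ])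
    ≡⟨ ∑-single (Unique.allFin⁺ (suc k)) (∈-allFin ρ₀) (λ {j} _ j≢ →
         ∑-0 (permutations k) λ {π} _ → []-no (insert zero j π ≈ₚ? ρ) λ eq → j≢ (eq zero)) ⟩
  ∑ (permutations k) (λ π → [ insert zero ρ₀ π ≈ₚ? ρ ])
    ≡⟨ ∑-cong (permutations k) (λ π →
         []-cong (insert zero ρ₀ π ≈ₚ? ρ) (π ≈ₚ? remove zero ρ) (restrict π) (extend π)) ⟩
  ∑ (permutations k) (λ π → [ π ≈ₚ? remove zero ρ ])
    ≡⟨ permutations-once (remove zero ρ) ⟩
  1 ∎
  where
  open ≡-Reasoning
  ρ₀ : Fin (suc k)
  ρ₀ = ρ ⟨$⟩ʳ zero
  restrict : ∀ π → (∀ i → insert zero ρ₀ π ⟨$⟩ʳ i ≡ ρ ⟨$⟩ʳ i) →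
    ∀ i → π ⟨$⟩ʳ i ≡ remove zero ρ ⟨$⟩ʳ i
  restrict π eq i = Fin.punchIn-injective ρ₀ _ _
    (trans (sym (Perm.insert-punchIn zero ρ₀ π i))
      (trans (eq (suc i)) (Perm.punchIn-permute ρ zero i)))
  extend : ∀ π → (∀ i → π ⟨$⟩ʳ i ≡ remove zero ρ ⟨$⟩ʳ i) →
    ∀ i → insert zero ρ₀ π ⟨$⟩ʳ i ≡ ρ ⟨$⟩ʳ i
  extend π eq zero    = refl
  extend π eq (suc i) = trans (Perm.insert-punchIn zero ρ₀ π i)
    (trans (cong (punchIn ρ₀) (eq i)) (sym (Perm.punchIn-permute ρ zero i)))

length-permutations : ∀ k → length (permutations k) ≡ k !
length-permutations zero    = refl
length-permutations (suc k) = begin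
  length (permutations (suc k))
    ≡⟨ trans (sym (ℕ.*-identityʳ _)) (sym (∑-const (permutations (suc k)) 1)) ⟩
  ∑ (permutations (suc k)) (λ _ → 1)
    ≡⟨ ∑-concatMap (λ j → map (insert zero j) (permutations k)) (allFin (suc k)) _ ⟩
  ∑ (allFin (suc k)) (λ j → ∑ (map (insert zero j) (permutations k)) λ _ → 1)
    ≡⟨ ∑-cong (allFin (suc k)) (λ j →
         trans (∑-const (map (insert zero j) (permutations k)) 1)
           (trans (ℕ.*-identityʳ _)
             (trans (List.length-map _ (permutations k)) (length-permutations k)))) ⟩
  ∑ (allFin (suc k)) (λ _ → k !)
    ≡⟨ ∑-const (allFin (suc k)) (k !) ⟩
  length (allFin (suc k)) * k !
    ≡⟨ cong (_* k !) (List.length-tabulate {n = suc k} (λ i → i)) ⟩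
  (suc k) ! ∎
  where open ≡-Reasoning

module _ {n : ℕ} {Λ : Partition n} where

  length-tableaux : length (tableaux Λ) ≡ n !
  length-tableaux = trans (List.length-map _ (permutations n)) (length-permutations n)

  tableaux-once : (S : Tableau Λ) → ∑ (tableaux Λ) (λ T → [ T ≈? S ]) ≡ 1
  tableaux-once S = begin
    ∑ (tableaux Λ) (λ T → [ T ≈? S ])
      ≡⟨ ∑-map (↔-trans (reading Λ)) (permutations n) _ ⟩
    ∑ (permutations n) (λ π → [ ↔-trans (reading Λ) π ≈? S ])
      ≡⟨ ∑-cong (permutations n) (λ π → []-cong (↔-trans (reading Λ) π ≈? S) (π ≈ₚ? ρ)
           (λ eq i → trans (cong (π ⟨$⟩ʳ_) (sym (Inverse.strictlyInverseˡ (reading Λ) i)))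
                       (eq (cellOf (reading Λ) i)))
           (λ eq x → trans (eq (reading Λ at x))
                       (cong (S at_) (Inverse.strictlyInverseʳ (reading Λ) x)))) ⟩
    ∑ (permutations n) (λ π → [ π ≈ₚ? ρ ])
      ≡⟨ permutations-once ρ ⟩
    1 ∎
    where
    open ≡-Reasoning
    ρ : Permutation′ n
    ρ = ↔-trans (↔-sym (reading Λ)) S

  -- The value of f at S is the sum of its values at the tableaux equal to S.
  ∑-≈? : (f : Tableau Λ → ℕ) → (∀ {S T} → S ≈ T → f S ≡ f T) → (S : Tableau Λ) →
    f S ≡ ∑ (tableaux Λ) (λ T → f T * [ T ≈? S ])
  ∑-≈? f f-≈ S = begin
    f S
      ≡⟨ sym (trans (cong (f S *_) (tableaux-once S)) (ℕ.*-identityʳ (f S))) ⟩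
    f S * ∑ (tableaux Λ) (λ T → [ T ≈? S ])
      ≡⟨ sym (∑-*ˡ (tableaux Λ) (f S) _) ⟩
    ∑ (tableaux Λ) (λ T → f S * [ T ≈? S ])
      ≡⟨ ∑-cong (tableaux Λ) same ⟩
    ∑ (tableaux Λ) (λ T → f T * [ T ≈? S ]) ∎
    where
    open ≡-Reasoning
    same : ∀ T → f S * [ T ≈? S ] ≡ f T * [ T ≈? S ]
    same T with T ≈? S
    ... | yes T≈S = cong (_* 1) (sym (f-≈ {T} {S} T≈S))
    ... | no _    = trans (ℕ.*-zeroʳ (f S)) (sym (ℕ.*-zeroʳ (f T)))

  -- The sum over all tableaux does not change when the entries are permuted.
  ∑-relabel : (f : Tableau Λ → ℕ) → (∀ {S T} → S ≈ T → f S ≡ f T) → (σ : Permutation′ n) →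
    ∑ (tableaux Λ) (λ T → f (↔-trans T σ)) ≡ ∑ (tableaux Λ) f
  ∑-relabel f f-≈ σ = begin
    ∑ (tableaux Λ) (λ T → f (↔-trans T σ))
      ≡⟨ ∑-cong (tableaux Λ) (λ T → ∑-≈? f (λ {S} {T} → f-≈ {S} {T}) (↔-trans T σ)) ⟩
    ∑ (tableaux Λ) (λ T → ∑ (tableaux Λ) λ S → f S * [ S ≈? ↔-trans T σ ])
      ≡⟨ ∑-swap (tableaux Λ) (tableaux Λ) _ ⟩
    ∑ (tableaux Λ) (λ S → ∑ (tableaux Λ) λ T → f S * [ S ≈? ↔-trans T σ ])
      ≡⟨ ∑-cong (tableaux Λ) (λ S → ∑-*ˡ (tableaux Λ) (f S) _) ⟩
    ∑ (tableaux Λ) (λ S → f S * ∑ (tableaux Λ) λ T → [ S ≈? ↔-trans T σ ])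
      ≡⟨ ∑-cong (tableaux Λ) (λ S → trans (cong (f S *_) (one S)) (ℕ.*-identityʳ (f S))) ⟩
    ∑ (tableaux Λ) f ∎
    where
    open ≡-Reasoning
    one : ∀ S → ∑ (tableaux Λ) (λ T → [ S ≈? ↔-trans T σ ]) ≡ 1
    one S = trans (∑-cong (tableaux Λ) λ T →
        []-cong (S ≈? ↔-trans T σ) (T ≈? ↔-trans S (flip σ))
          (λ eq x → sym (trans (cong (σ ⟨$⟩ˡ_) (eq x)) (Perm.inverseˡ σ)))
          (λ eq x → sym (trans (cong (σ ⟨$⟩ʳ_) (eq x)) (Perm.inverseʳ σ))))
      (tableaux-once (↔-trans S (flip σ)))

  -- By symmetry the count is the same for all entries b, and these n counts add
  -- up to n!.
  tableaux-with : (x : Cell Λ) (b : Fin n) →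
    ∑ (tableaux Λ) (λ T → [ T at x Fin.≟ b ]) ≡ (n ∸ 1) !
  tableaux-with x b = cancel b (begin
    n * N b
      ≡⟨ cong (_* N b) (sym (List.length-tabulate {n = n} (λ i → i))) ⟩
    length (allFin n) * N b
      ≡⟨ sym (∑-const (allFin n) (N b)) ⟩
    ∑ (allFin n) (λ _ → N b)
      ≡⟨ ∑-cong (allFin n) (λ c → symmetric c) ⟩
    ∑ (allFin n) N
      ≡⟨ ∑-swap (allFin n) (tableaux Λ) _ ⟩
    ∑ (tableaux Λ) (λ T → ∑ (allFin n) λ c → [ T at x Fin.≟ c ])
      ≡⟨ ∑-cong (tableaux Λ) (λ T → trans
           (∑-single (Unique.allFin⁺ n) (∈-allFin (T at x)) λ _ c≢ → []-no (T at x Fin.≟ _) (c≢ ∘ sym))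
           ([]-yes (T at x Fin.≟ T at x) refl)) ⟩
    ∑ (tableaux Λ) (λ _ → 1)
      ≡⟨ trans (∑-const (tableaux Λ) 1) (ℕ.*-identityʳ _) ⟩
    length (tableaux Λ)
      ≡⟨ length-tableaux ⟩
    n ! ∎)
    where
    open ≡-Reasoning
    N : Fin n → ℕ
    N c = ∑ (tableaux Λ) (λ T → [ T at x Fin.≟ c ])
    symmetric : ∀ c → N b ≡ N c
    symmetric c = trans
      (∑-cong (tableaux Λ) λ T → []-cong (T at x Fin.≟ b) (τ ⟨$⟩ʳ (T at x) Fin.≟ c)
        (λ e → trans (cong (τ ⟨$⟩ʳ_) e) (transpose-l b c))
        (λ e → trans (sym (Perm.inverseˡ τ)) (trans (cong (τ ⟨$⟩ˡ_) e)
          (trans (cong (τ ⟨$⟩ˡ_) (sym (transpose-l b c))) (Perm.inverseˡ τ)))))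
      (∑-relabel (λ T → [ T at x Fin.≟ c ])
        (λ {S} {T} eq → []-cong (S at x Fin.≟ c) (T at x Fin.≟ c)
          (λ e → trans (sym (eq x)) e) (λ e → trans (eq x) e)) τ)
      where
      τ : Permutation′ n
      τ = transpose b c
    cancel : ∀ {k l} → Fin k → k * l ≡ k ! → l ≡ (k ∸ 1) !
    cancel {suc k} _ eq = ℕ.*-cancelˡ-≡ _ _ (suc k) eq

-- Counting the exchanges

module _ {n : ℕ} {Λ : Partition n} (U : SYT Λ) where

  -- The algorithm applied to T.
  sorting : Tableau Λ → Run U
  sorting T = seq U T , λ s → step-next U (seq U T s)

  seq-≈ : {S T : Tableau Λ} → S ≈ T → ∀ s → seq U S s ≈ seq U T s
  seq-≈ eq zero    = eq
  seq-≈ {S} {T} eq (suc s) =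
    Next-≈ {U = U} {seq U S s} {seq U S (suc s)} {seq U T s} {seq U T (suc s)}
      (Run.next (sorting T) s) (Run.next (sorting S) s) (seq-≈ {S} {T} eq s)

  ¬Standard⇒<r : (T : Tableau Λ) (s : ℕ) → ¬ Standard (seq U T s) → s < r U T
  ¬Standard⇒<r T s ¬std = ¬Standard⇒< (sorting T) (proj₁ (proj₂ (stops U T))) ¬std

  Exchanges⇒Move : {a b : Fin n} {x y : Cell Λ} (T : Tableau Λ) (s : ℕ) → a Fin.< b →
    Exchanges U a b x y T s → Move U (seq U T s) y x
  Exchanges⇒Move T s = Exchanged⇒Move {U = U} {seq U T s} {seq U T (suc s)} (Run.next (sorting T) s)

  Exchanges⇒<r : {a b : Fin n} {x y : Cell Λ} (T : Tableau Λ) (s : ℕ) → a Fin.< b →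
    Exchanges U a b x y T s → s < r U T
  Exchanges⇒<r T s a<b ex =
    ¬Standard⇒<r T s (Move⇒¬Standard {U = U} {T = seq U T s} (Exchanges⇒Move T s a<b ex))

  m-∑ : {a b : Fin n} (x y : Cell Λ) → a Fin.< b → m U a b x y ≡
    ∑ (tableaux Λ) λ T → ∑< (r U T) λ s → [ exchanged? (seq U T s) (seq U T (suc s)) a b x y ]
  m-∑ {a} {b} x y a<b = trans
    (length-filter (λ T → ℕ.anyUpTo? (exchanges? U a b x y T) (r U T)) (tableaux Λ))
    (∑-cong (tableaux Λ) λ T →
      ∑<-once (exchanges? U a b x y T) (r U T) (exchanged-once (sorting T) a<b))

  -- In the sorting of σ ∘ T, the exchange of a with b′ takes place at the same
  -- time as the exchange of a with b in the sorting of T.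
  Exchanges-relabel : {a b b′ : Fin n} {x y : Cell Λ} {σ : Permutation′ n} →
    Replaces b b′ σ → a Fin.< b → a Fin.< b′ → σ ⟨$⟩ʳ a ≡ a →
    {T T′ : Tableau Λ} → T′ ≈[ σ ] T →
    (∃[ s ] (s < r U T × Exchanges U a b x y T s)) →
    (∃[ s ] (s < r U T′ × Exchanges U a b′ x y T′ s))
  Exchanges-relabel rep a<b a<b′ fixed {T} {T′} start (s , _ , ex) =
    s , Exchanges⇒<r T′ s a<b′ ex′ , ex′
    where
    ex′ = Parallel.exchanged-in-parallel rep (sorting T) (sorting T′) a<b a<b′ fixed start {s}
      (Exchanges⇒Move T s a<b ex) (proj₂ (proj₁ ex)) (proj₁ (proj₁ ex))

-- The local exchange numbers do not depend on the greater entry.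
m-independent : {n : ℕ} {Λ : Partition n} (U : SYT Λ) {a b b′ : Fin n} (x y : Cell Λ) →
  a Fin.< b → a Fin.< b′ → m U a b x y ≡ m U a b′ x y
m-independent {suc k} {Λ} U {a} {b} {b′} x y a<b a<b′ = begin
  m U a b x y
    ≡⟨ length-filter (exchanging? b) (tableaux Λ) ⟩
  ∑ (tableaux Λ) (λ T → [ exchanging? b T ])
    ≡⟨ ∑-cong (tableaux Λ) (λ T → []-cong (exchanging? b T) (exchanging? b′ (↔-trans T σ))
         (Exchanges-relabel U (replacement-replaces b b′) a<b a<b′
           (replacement-fixes b b′ a<b a<b′) {T} {↔-trans T σ} (λ _ → refl))
         (Exchanges-relabel U (replacement-replaces b′ b) a<b′ a<b
           (replacement-fixes b′ b a<b′ a<b) {↔-trans T σ} {T}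
           (λ w → sym (replacement-inverse b b′ (T at w))))) ⟩
  ∑ (tableaux Λ) (λ T → [ exchanging? b′ (↔-trans T σ) ])
    ≡⟨ ∑-relabel (λ T → [ exchanging? b′ T ])
         (λ {S} {T} eq → []-cong (exchanging? b′ S) (exchanging? b′ T)
           (transfer {S} {T} eq) (transfer {T} {S} λ w → sym (eq w)))
         σ ⟩
  ∑ (tableaux Λ) (λ T → [ exchanging? b′ T ])
    ≡⟨ sym (length-filter (exchanging? b′) (tableaux Λ)) ⟩
  m U a b′ x y ∎
  where
  open ≡-Reasoning
  σ : Permutation′ (suc k)
  σ = replacement b b′
  Exchanging : Fin (suc k) → Tableau Λ → Set
  Exchanging c T = ∃[ s ] (s < r U T × Exchanges U a c x y T s)
  exchanging? : ∀ c T → Dec (Exchanging c T)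
  exchanging? c T = ℕ.anyUpTo? (exchanges? U a c x y T) (r U T)
  transfer : {S T : Tableau Λ} → S ≈ T → Exchanging b′ S → Exchanging b′ T
  transfer {S} {T} eq (s , _ , ((Sx , Sy) , (S′x , S′y))) = s , Exchanges⇒<r U T s a<b′ ex , ex
    where
    e : ∀ i w → seq U T i at w ≡ seq U S i at w
    e i w = sym (seq-≈ U {S} {T} eq i w)
    ex : Exchanges U a b′ x y T s
    ex = (trans (e s x) Sx , trans (e s y) Sy) ,
         (trans (e (suc s) x) S′x , trans (e (suc s) y) S′y)

module _ {n : ℕ} {Λ : Partition n} (U : SYT Λ) where

  -- The drop cell of b in the sorting of T.
  dropped : Fin n → Tableau Λ → Cell Λ
  dropped b T = proj₁ (Drop.drop-cell (sorting U T) b (r U T))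

  module _ (b : Fin n) (T : Tableau Λ) where

    private
      drop : Drop.DropCell (sorting U T) b (r U T) (dropped b T)
      drop = proj₂ (Drop.drop-cell (sorting U T) b (r U T))

    drops?≡ : (x : Cell Λ) → [ drops? U b x T ] ≡ [ dropped b T ≟ᶜ x ]
    drops?≡ x = []-cong (drops? U b x T) (dropped b T ≟ᶜ x)
      (Drop.dropped⇒≡ (sorting U T) b drop) (Drop.≡⇒dropped (sorting U T) b drop)

    -- The total, over the sorting of T, of the exchanges of b at x which f counts.
    total : ((T T′ : Tableau Λ) → Fin n → Cell Λ → ℕ) → Cell Λ → ℕ
    total f x = ∑< (r U T) λ s → f (seq U T s) (seq U T (suc s)) b x

    fallen-total : (x : Cell Λ) →
      Balance [ drops? U b x T ] (total fall-out x) [ T at x Fin.≟ b ] (total fall-in x)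
    fallen-total x = balance-now (drops?≡ x) (Drop.DropCell.fallen drop x)

    risen-total : (x : Cell Λ) →
      Balance [ seq U T (r U T) at x Fin.≟ b ] (total rise-out x)
              [ drops? U b x T ] (total rise-in x)
    risen-total x = balance-then (sym (drops?≡ x)) (Drop.DropCell.risen drop x)

  -- The four functions lo, hi, X and Y choose the roles of the indices a and y,
  -- so that a or a fixed entry is the smaller one, and y or a fixed cell is the
  -- cell which the smaller entry leaves.
  m-flow : (as : List (Fin n)) (ys : List (Cell Λ)) (lo hi : Fin n → Fin n)
    (X Y : Cell Λ → Cell Λ) → (∀ {a} → a ∈ as → lo a Fin.< hi a) →
    ∑ as (λ a → ∑ ys λ y → m U (lo a) (hi a) (X y) (Y y)) ≡
    ∑ (tableaux Λ) λ T → ∑< (r U T) λ s → ∑ as λ a → ∑ ys λ y →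
      [ exchanged? (seq U T s) (seq U T (suc s)) (lo a) (hi a) (X y) (Y y) ]
  m-flow as ys lo hi X Y lo<hi = begin
    ∑ as (λ a → ∑ ys λ y → m U (lo a) (hi a) (X y) (Y y))
      ≡⟨ ∑-cong∈ as (λ {a} a∈ → trans
           (∑-cong ys λ y → m-∑ U (X y) (Y y) (lo<hi a∈))
           (∑-swap ys (tableaux Λ) λ y T → ∑< (r U T) λ s → e T s a y)) ⟩
    ∑ as (λ a → ∑ (tableaux Λ) λ T → ∑ ys λ y → ∑< (r U T) λ s → e T s a y)
      ≡⟨ ∑-swap as (tableaux Λ) (λ a T → ∑ ys λ y → ∑< (r U T) λ s → e T s a y) ⟩
    ∑ (tableaux Λ) (λ T → ∑ as λ a → ∑ ys λ y → ∑< (r U T) λ s → e T s a y)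
      ≡⟨ ∑-cong (tableaux Λ) (λ T → trans
           (∑-cong as λ a → sym (∑<-∑ (r U T) ys λ s y → e T s a y))
           (sym (∑<-∑ (r U T) as λ s a → ∑ ys λ y → e T s a y))) ⟩
    ∑ (tableaux Λ) (λ T → ∑< (r U T) λ s → ∑ as λ a → ∑ ys λ y → e T s a y) ∎
    where
    open ≡-Reasoning
    e : Tableau Λ → ℕ → Fin n → Cell Λ → ℕ
    e T s a y = [ exchanged? (seq U T s) (seq U T (suc s)) (lo a) (hi a) (X y) (Y y) ]

  d-∑ : (b : Fin n) (x : Cell Λ) → d U b x ≡ ∑ (tableaux Λ) λ T → [ drops? U b x T ]
  d-∑ b x = length-filter (drops? U b x) (tableaux Λ)

  -- For a < b, the numbers of exchanges of a and b in which a leaves x, or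
  -- enters x.  Their difference is the signed exit number of a at x.
  outgoing incoming : Fin n → Fin n → Cell Λ → ℕ
  outgoing a b x = ∑ (N⁻ x) λ y → m U a b x y
  incoming a b x = ∑ (N⁺ x) λ y → m U a b y x

  fall-balance : (b : Fin n) (x : Cell Λ) →
    d U b x + ∑ (below b) (λ a → incoming a b x) ≡
    (n ∸ 1) ! + ∑ (below b) (λ a → outgoing a b x)
  fall-balance b x = begin
    d U b x + ∑ (below b) (λ a → incoming a b x)
      ≡⟨ cong₂ _+_ (d-∑ b x)
           (m-flow (below b) (N⁺ x) (λ a → a) (λ _ → b) (λ y → y) (λ _ → x) ∈-below⁻) ⟩
    ∑ (tableaux Λ) (λ T → [ drops? U b x T ]) + ∑ (tableaux Λ) (λ T → total b T fall-out x)
      ≡⟨ sym (∑-+ (tableaux Λ) _ _) ⟩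
    ∑ (tableaux Λ) (λ T → [ drops? U b x T ] + total b T fall-out x)
      ≡⟨ ∑-cong (tableaux Λ) (λ T → Balance.balance (fallen-total b T x)) ⟩
    ∑ (tableaux Λ) (λ T → [ T at x Fin.≟ b ] + total b T fall-in x)
      ≡⟨ ∑-+ (tableaux Λ) _ _ ⟩
    ∑ (tableaux Λ) (λ T → [ T at x Fin.≟ b ]) + ∑ (tableaux Λ) (λ T → total b T fall-in x)
      ≡⟨ cong₂ _+_ (tableaux-with x b)
           (sym (m-flow (below b) (N⁻ x) (λ a → a) (λ _ → b) (λ _ → x) (λ y → y) ∈-below⁻)) ⟩
    (n ∸ 1) ! + ∑ (below b) (λ a → outgoing a b x) ∎
    where open ≡-Reasoning

  -- The number of tableaux T whose sorted tableau has b at x.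
  final : Fin n → Cell Λ → ℕ
  final b x = ∑ (tableaux Λ) λ T → [ tableau (φ U T) at x Fin.≟ b ]

  rise-balance : (b : Fin n) (x : Cell Λ) →
    final b x + ∑ (above b) (λ c → outgoing b c x) ≡
    d U b x + ∑ (above b) (λ c → incoming b c x)
  rise-balance b x = begin
    final b x + ∑ (above b) (λ c → outgoing b c x)
      ≡⟨ cong (final b x +_)
           (m-flow (above b) (N⁻ x) (λ _ → b) (λ c → c) (λ _ → x) (λ y → y) ∈-above⁻) ⟩
    final b x + ∑ (tableaux Λ) (λ T → total b T rise-out x)
      ≡⟨ sym (∑-+ (tableaux Λ) _ _) ⟩
    ∑ (tableaux Λ) (λ T → [ tableau (φ U T) at x Fin.≟ b ] + total b T rise-out x)
      ≡⟨ ∑-cong (tableaux Λ) (λ T → Balance.balance (risen-total b T x)) ⟩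
    ∑ (tableaux Λ) (λ T → [ drops? U b x T ] + total b T rise-in x)
      ≡⟨ ∑-+ (tableaux Λ) _ _ ⟩
    ∑ (tableaux Λ) (λ T → [ drops? U b x T ]) + ∑ (tableaux Λ) (λ T → total b T rise-in x)
      ≡⟨ cong₂ _+_ (sym (d-∑ b x))
           (sym (m-flow (above b) (N⁺ x) (λ _ → b) (λ c → c) (λ y → y) (λ _ → x) ∈-above⁻)) ⟩
    d U b x + ∑ (above b) (λ c → incoming b c x) ∎
    where open ≡-Reasoning

-- Drop function and distribution vector

-- The number of tableaux whose sorted tableau has b at x is a sum over the
-- tableaux W with b at x: the number of T which are sorted to W is z U W if W is
-- standard, and 0 otherwise.
final-cong : {n : ℕ} {Λ : Partition n} (U V : SYT Λ) → (∀ W → z U W ≡ z V W) →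
  (b : Fin n) (x : Cell Λ) → final U b x ≡ final V b x
final-cong {Λ = Λ} U V z≡ b x =
  trans (by-result U) (trans (∑-cong (tableaux Λ) λ W → cong ([ W at x Fin.≟ b ] *_) (same W))
    (sym (by-result V)))
  where
  open ≡-Reasoning
  arrivals : SYT Λ → Tableau Λ → ℕ
  arrivals U W = ∑ (tableaux Λ) λ T → [ W ≈? tableau (φ U T) ]
  by-result : ∀ U → final U b x ≡ ∑ (tableaux Λ) λ W → [ W at x Fin.≟ b ] * arrivals U W
  by-result U = begin
    ∑ (tableaux Λ) (λ T → [ tableau (φ U T) at x Fin.≟ b ])
      ≡⟨ ∑-cong (tableaux Λ) (λ T → ∑-≈? (λ W → [ W at x Fin.≟ b ]) (λ {S} {T} eq →
           []-cong (S at x Fin.≟ b) (T at x Fin.≟ b)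
             (trans (sym (eq x))) (trans (eq x))) (tableau (φ U T))) ⟩
    ∑ (tableaux Λ) (λ T → ∑ (tableaux Λ) λ W → [ W at x Fin.≟ b ] * [ W ≈? tableau (φ U T) ])
      ≡⟨ ∑-swap (tableaux Λ) (tableaux Λ)
           (λ T W → [ W at x Fin.≟ b ] * [ W ≈? tableau (φ U T) ]) ⟩
    ∑ (tableaux Λ) (λ W → ∑ (tableaux Λ) λ T → [ W at x Fin.≟ b ] * [ W ≈? tableau (φ U T) ])
      ≡⟨ ∑-cong (tableaux Λ) (λ W → ∑-*ˡ (tableaux Λ) [ W at x Fin.≟ b ] _) ⟩
    ∑ (tableaux Λ) (λ W → [ W at x Fin.≟ b ] * arrivals U W) ∎
  arrivals-z : ∀ U (W : SYT Λ) → arrivals U (tableau W) ≡ z U W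
  arrivals-z U W = sym (trans
    (length-filter (λ T → tableau (φ U T) ≈? tableau W) (tableaux Λ))
    (∑-cong (tableaux Λ) λ T →
      []-cong (tableau (φ U T) ≈? tableau W) (tableau W ≈? tableau (φ U T))
        (λ eq w → sym (eq w)) (λ eq w → sym (eq w))))
  arrivals-0 : ∀ U (W : Tableau Λ) → ¬ Standard W → arrivals U W ≡ 0
  arrivals-0 U W ¬std = ∑-0 (tableaux Λ) λ {T} _ → []-no (W ≈? tableau (φ U T)) λ eq →
    ¬std (Standard-≈ {U = U} {tableau (φ U T)} {W} eq (standard (φ U T)))
  same : ∀ W → arrivals U W ≡ arrivals V W
  same W = cases (standard? W)
    where
    cases : Dec (Standard W) → arrivals U W ≡ arrivals V W
    cases (yes std) = trans (arrivals-z U W′) (trans (z≡ W′) (sym (arrivals-z V W′)))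
      where
      W′ : SYT Λ
      W′ = record { tableau = W ; standard = std }
    cases (no ¬std) = trans (arrivals-0 U W ¬std) (sym (arrivals-0 V W ¬std))

module _ {n : ℕ} {Λ : Partition n} (U : SYT Λ) where

  outgoing-independent : {a b c : Fin n} (x : Cell Λ) → a Fin.< b → a Fin.< c →
    outgoing U a b x ≡ outgoing U a c x
  outgoing-independent x a<b a<c = ∑-cong (N⁻ x) λ y → m-independent U x y a<b a<c

  incoming-independent : {a b c : Fin n} (x : Cell Λ) → a Fin.< b → a Fin.< c →
    incoming U a b x ≡ incoming U a c x
  incoming-independent x a<b a<c = ∑-cong (N⁺ x) λ y → m-independent U y x a<b a<c

  drop-formula : (x : Cell Λ) (b : Fin n) (c : Fin n → Fin n) →
    (∀ a → a Fin.< b → a Fin.< c a) →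
    ℤ.+ d U b x ≡ ℤ.+ ((n ∸ 1) !) ℤ.+ Σ< b (λ a → Δ U a (c a) x)
  drop-formula x b c a<c = signed-sum (below b)
    {λ a → outgoing U a b x} {λ a → outgoing U a (c a) x}
    {λ a → incoming U a b x} {λ a → incoming U a (c a) x}
    {d U b x} {(n ∸ 1) !} (fall-balance U b x)
    (λ {a} a∈ → outgoing-independent x (∈-below⁻ a∈) (a<c a (∈-below⁻ a∈)))
    (λ {a} a∈ → incoming-independent x (∈-below⁻ a∈) (a<c a (∈-below⁻ a∈)))

  -- The balance of the rises of a, in which all greater entries have the same
  -- share.
  rise-balance′ : {a b : Fin n} (x : Cell Λ) → a Fin.< b →
    final U a x + length (above a) * outgoing U a b x ≡
    d U a x + length (above a) * incoming U a b x
  rise-balance′ {a} {b} x a<b = constant-flow (above a)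
    {λ c → outgoing U a c x} {λ c → incoming U a c x} {final U a x} {d U a x}
    (rise-balance U a x)
    (λ c∈ → outgoing-independent x (∈-above⁻ c∈) a<b)
    (λ c∈ → incoming-independent x (∈-above⁻ c∈) a<b)

module _ {n : ℕ} {Λ : Partition n} (U V : SYT Λ) (z≡ : ∀ W → z U W ≡ z V W) (x : Cell Λ) where

  -- The signed exit numbers of a at x for U and for V are equal.
  exits-cong : {a b : Fin n} → a Fin.< b → d U a x ≡ d V a x →
    outgoing U a b x + incoming V a b x ≡ outgoing V a b x + incoming U a b x
  exits-cong {a} {b} a<b d≡ = cross-multiple (∈-above⁺ a<b) {final U a x} {final V a x}
    {d U a x} {d V a x} (rise-balance′ U x a<b) (rise-balance′ V x a<b)
    (final-cong U V z≡ a x) d≡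

  d-cong-step : (b : Fin n) → (∀ {a} → a Fin.< b → d U a x ≡ d V a x) → d U b x ≡ d V b x
  d-cong-step b d≡ = ∑-cross (below b)
    {λ a → outgoing U a b x} {λ a → outgoing V a b x}
    {λ a → incoming U a b x} {λ a → incoming V a b x} {d U b x} {d V b x} {(n ∸ 1) !}
    (fall-balance U b x) (fall-balance V b x)
    (λ a∈ → exits-cong (∈-below⁻ a∈) (d≡ (∈-below⁻ a∈)))

  d-cong : (b : Fin n) → d U b x ≡ d V b x
  d-cong = wfRec _ d-cong-step
    where open WF.All Fin.<-wellFounded Level.zero

corollary5p4 : ∀ {n : ℕ} (Λ : Partition n) →
    (∀ (U : SYT Λ) (x : Cell Λ) (b : Fin n)
    (c : Fin n → Fin n) → (∀ a → a Fin.< b → a Fin.< c a) →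
    ℤ.+ d U b x ≡ ℤ.+ ((n ∸ 1) !) ℤ.+ Σ< b (λ a → Δ U a (c a) x))
    ×
    (∀ (U V : SYT Λ) → (∀ (W : SYT Λ) → z U W ≡ z V W) →
    ∀ (x : Cell Λ) (b : Fin n) → d U b x ≡ d V b x)
corollary5p4 Λ = drop-formula , d-cong
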